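{- Let $T$ and $S$ be two trees, each containing at least one edge. Then $\mathrm{ex}(n,T\Box S)=\Theta_{T,S}(n^{3/2})$; that is, there are constants $c,C>0$ depending only on $T$ and $S$ such that $c\,n^{3/2}\le \mathrm{ex}(n,T\Box S)\le C\,n^{3/2}$ for all sufficiently large positive integers $n$.
   Context: All graphs are finite and simple. For a graph $F$ and a positive integer $n$, the Turán number $\mathrm{ex}(n,F)$ is the maximum number of edges in an $n$-vertex graph containing no subgraph isomorphic to $F$. For graphs $F$ and $G$, the Cartesian product $F\Box G$ is the graph with vertex set $V(F)\times V(G)$ in which $(u,v)$ and $(u',v')$ are adjacent if and only if either $u=u'$ and $vv'\in E(G)$, or $v=v'$ and $uu'\in E(F)$. -}

module Defs where

open import Data.Empty using (⊥)
open import Data.Fin as Fin using (Fin; zero; suc; inject₁; fromℕ; combine; remQuot)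
open import Data.Fin.Properties as Fin using (any?; all?; inj⇒≟; remQuot-combine; *↔×)
open import Data.Fin.Subset using (Subset; _∈_)
open import Data.Fin.Subset.Properties using (anySubset?; _∈?_)
open import Data.Integer using (+_)
open import Data.List using (List; length; filter; allFin; cartesianProduct)
open import Data.List.Properties using (length-filter; filter-≐)
open import Data.Nat as ℕ using (ℕ; zero; suc; _+_; _*_; _≤_; z≤n)
open import Data.Nat.Properties using (m≤n⇒m<n∨m≡n; ≤-pred)
open import Data.Product using (Σ; ∃; ∃₂; _×_; _,_)
open import Data.Product.Function.NonDependent.Propositional using (_×-↔_)
open import Data.Rational using (ℚ; _/_)
open import Data.Sum using (_⊎_; inj₁; inj₂)
open import Data.Vec using (lookup; tabulate)
open import Data.Vec.Properties using ([]=⇒lookup; lookup⇒[]=; lookup∘tabulate)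
open import Data.Vec.Functional as VecF using ()
open import Function using (_∘_; id; _↔_; Inverse; Injection)
open import Function.Definitions using (Injective)
open import Function.Properties.Inverse using (↔-refl; ↔-sym; ↔-trans; ↔⇒↣)
open import Relation.Binary using (Symmetric; Irreflexive; Decidable; DecidableEquality)
open import Relation.Binary.Construct.Closure.ReflexiveTransitive using (Star)
open import Relation.Binary.PropositionalEquality
open import Relation.Nullary using (¬_; Dec; yes; no; does; contradiction)
open import Relation.Nullary.Decidable
  using (map′; _×-dec_; _⊎-dec_; _→-dec_; ¬?; dec-true)
import Relation.Unary as U

record Graph : Set₁ where
  field
    V           : Set
    order       : ℕ
    enum        : V ↔ Fin order
    Adj         : V → V → Set
    _adj?_      : Decidable Adj
    symmetric   : Symmetric Adj
    irreflexive : Irreflexive _≡_ Adj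

  open Inverse enum public using () renaming (to to index; from to vertex)

  vertex-index : ∀ v → vertex (index v) ≡ v
  vertex-index = Inverse.strictlyInverseʳ enum

  index-vertex : ∀ i → index (vertex i) ≡ i
  index-vertex = Inverse.strictlyInverseˡ enum

  index-injective : Injective _≡_ _≡_ index
  index-injective = Injection.injective (↔⇒↣ enum)

  vertex-injective : Injective _≡_ _≡_ vertex
  vertex-injective = Injection.injective (↔⇒↣ (↔-sym enum))

  _≟_ : DecidableEquality V
  _≟_ = inj⇒≟ (↔⇒↣ enum)

open Graph using (V; order)

HasEdge : Graph → Set
HasEdge G = ∃₂ λ u v → Graph.Adj G u v

Connected : Graph → Set
Connected G = V G × (∀ u v → Star (Graph.Adj G) u v)

-- f 0, f 1, …, f (k + 2) are the vertices of a cycle of length k + 3.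
record Cycle (G : Graph) : Set where
  open Graph G using (Adj)
  field
    k        : ℕ
    f        : Fin (3 + k) → V G
    distinct : Injective _≡_ _≡_ f
    step     : ∀ (i : Fin (2 + k)) → Adj (f (inject₁ i)) (f (suc i))
    close    : Adj (f (fromℕ (2 + k))) (f zero)

IsTree : Graph → Set
IsTree G = Connected G × ¬ Cycle G

infixr 7 _□_

_□_ : Graph → Graph → Graph
F □ G = record
  { V           = V F × V G
  ; order       = order F * order G
  ; enum        = ↔-trans (F.enum ×-↔ G.enum) (↔-sym *↔×)
  ; Adj         = λ (u , v) (u′ , v′) → (u ≡ u′ × G.Adj v v′) ⊎ (v ≡ v′ × F.Adj u u′)
  ; _adj?_      = λ (u , v) (u′ , v′) →
      ((u F.≟ u′) ×-dec (v G.adj? v′)) ⊎-dec ((v G.≟ v′) ×-dec (u F.adj? u′))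
  ; symmetric   = λ { (inj₁ (refl , a)) → inj₁ (refl , G.symmetric a)
                    ; (inj₂ (refl , a)) → inj₂ (refl , F.symmetric a) }
  ; irreflexive = λ { refl (inj₁ (_ , a)) → G.irreflexive refl a
                    ; refl (inj₂ (_ , a)) → F.irreflexive refl a }
  }
  where
  module F = Graph F
  module G = Graph G

-- A (not necessarily induced) subgraph of G isomorphic to F is the image of
-- an injective edge-preserving map V F → V G.
IsCopy : (F G : Graph) → (V F → V G) → Set
IsCopy F G f =
  Injective _≡_ _≡_ f × (∀ {u v} → Graph.Adj F u v → Graph.Adj G (f u) (f v))

infix 4 _⊑_

_⊑_ : Graph → Graph → Set
F ⊑ G = ∃ (IsCopy F G)

pairs : ∀ n → List (Fin n × Fin n)
pairs n = filter (λ (i , j) → i Fin.<? j) (cartesianProduct (allFin n) (allFin n))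

-- Each edge is counted once, as the pair of its endpoints in the order given
-- by the enumeration of the vertices.
edgeCount : Graph → ℕ
edgeCount G = length (filter (λ (i , j) → vertex i adj? vertex j) (pairs (order G)))
  where open Graph G using (vertex; _adj?_)

Attained : ℕ → Graph → ℕ → Set₁
Attained n F m =
  Σ Graph λ G → order G ≡ n × ¬ (F ⊑ G) × edgeCount G ≡ m

IsTuránNumber : ℕ → Graph → ℕ → Set₁
IsTuránNumber n F m = Attained n F m × (∀ k → Attained n F k → k ≤ m)

-- The maximum is computed by exhaustive search, which requires deciding
-- Attained.

module _ (G : Graph) where
  open Graph G

  allV? : {P : V G → Set} → U.Decidable P → Dec (∀ v → P v)
  allV? {P} P? = map′ (λ h v → subst P (vertex-index v) (h (index v))) (λ h i → h (vertex i))
                      (all? (P? ∘ vertex))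

anyFunction? : ∀ {n} k {P : (Fin k → Fin n) → Set} →
               (∀ {f g} → f ≗ g → P f → P g) → U.Decidable P → Dec (∃ P)
anyFunction? zero resp P? =
  map′ (VecF.[] ,_) (λ (_ , p) → resp (λ ()) p) (P? VecF.[])
anyFunction? (suc k) resp P? =
  map′ (λ (b , f , p) → b VecF.∷ f , p)
       (λ (f , p) → f zero , f ∘ suc , resp (λ { zero → refl ; (suc i) → refl }) p)
       (any? λ b → anyFunction? k
         (λ f≗g → resp λ { zero → refl ; (suc i) → f≗g i })
         (λ f → P? (b VecF.∷ f)))

module _ (F G : Graph) where
  private
    module F = Graph F
    module G = Graph G

  isCopy? : U.Decidable (IsCopy F G)
  isCopy? f =
    map′ (λ h {u} {v} → h u v) (λ h u v → h {u} {v})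
         (allV? F λ u → allV? F λ v → (f u G.≟ f v) →-dec (u F.≟ v))
    ×-dec
    map′ (λ h {u} {v} → h u v) (λ h u v → h {u} {v})
         (allV? F λ u → allV? F λ v → (u F.adj? v) →-dec (f u G.adj? f v))

  isCopy-resp : ∀ {f g} → f ≗ g → IsCopy F G f → IsCopy F G g
  isCopy-resp f≗g (inj , hom) =
    (λ {u} {v} e → inj (trans (f≗g u) (trans e (sym (f≗g v))))) ,
    (λ {u} {v} a → subst₂ G.Adj (f≗g u) (f≗g v) (hom a))

  _⊑?_ : Dec (F ⊑ G)
  _⊑?_ = map′
    (λ (h , p) → G.vertex ∘ h ∘ F.index , p)
    (λ (f , p) → G.index ∘ f ∘ F.vertex ,
      isCopy-resp (λ v → sym (trans (G.vertex-index _) (cong f (F.vertex-index v)))) p)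
    (anyFunction? (order F)
      (λ f≗g → isCopy-resp (cong G.vertex ∘ f≗g ∘ F.index))
      (λ h → isCopy? (G.vertex ∘ h ∘ F.index)))

-- Every set of pairs yields a graph on Fin n, after symmetrising and removing
-- loops.
fromSubset : ∀ n → Subset (n * n) → Graph
fromSubset n s = record
  { V           = Fin n
  ; order       = n
  ; enum        = ↔-refl
  ; Adj         = λ i j → ¬ i ≡ j × (combine i j ∈ s ⊎ combine j i ∈ s)
  ; _adj?_      = λ i j → ¬? (i Fin.≟ j) ×-dec ((combine i j ∈? s) ⊎-dec (combine j i ∈? s))
  ; symmetric   = λ { (i≢j , inj₁ a) → i≢j ∘ sym , inj₂ a
                    ; (i≢j , inj₂ a) → i≢j ∘ sym , inj₁ a }
  ; irreflexive = λ i≡j (i≢j , _) → i≢j i≡j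
  }

module _ (G : Graph) where
  open Graph G using (Adj; _adj?_; vertex; index; vertex-index; vertex-injective)

  toSubset : Subset (order G * order G)
  toSubset = tabulate λ p →
    let (i , j) = remQuot (order G) p in does (vertex i adj? vertex j)

  private
    lookup-toSubset : ∀ i j → does (vertex i adj? vertex j) ≡ lookup toSubset (combine i j)
    lookup-toSubset i j = sym (trans
      (lookup∘tabulate _ (combine i j))
      (cong (λ (i , j) → does (vertex i adj? vertex j)) (remQuot-combine i j)))

  adj⇒∈ : ∀ {i j} → Adj (vertex i) (vertex j) → combine i j ∈ toSubset
  adj⇒∈ {i} {j} a = lookup⇒[]= _ _
    (trans (sym (lookup-toSubset i j)) (dec-true (vertex i adj? vertex j) a))

  ∈⇒adj : ∀ {i j} → combine i j ∈ toSubset → Adj (vertex i) (vertex j)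
  ∈⇒adj {i} {j} i∈ with vertex i adj? vertex j | trans (lookup-toSubset i j) ([]=⇒lookup i∈)
  ... | yes a | _ = a

  adj⇒adj′ : ∀ {i j} → Adj (vertex i) (vertex j) → Graph.Adj (fromSubset (order G) toSubset) i j
  adj⇒adj′ a = (λ i≡j → Graph.irreflexive G (cong vertex i≡j) a) , inj₁ (adj⇒∈ a)

  adj′⇒adj : ∀ {i j} → Graph.Adj (fromSubset (order G) toSubset) i j → Adj (vertex i) (vertex j)
  adj′⇒adj (_ , inj₁ i∈) = ∈⇒adj i∈
  adj′⇒adj (_ , inj₂ i∈) = Graph.symmetric G (∈⇒adj i∈)

  edgeCount-fromSubset : edgeCount (fromSubset (order G) toSubset) ≡ edgeCount G
  edgeCount-fromSubset = cong length
    (filter-≐ _ _ ((λ {_} → adj′⇒adj) , (λ {_} → adj⇒adj′)) (pairs (order G)))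

  ⊑-fromSubset : ∀ F → F ⊑ fromSubset (order G) toSubset → F ⊑ G
  ⊑-fromSubset F (f , inj , hom) = vertex ∘ f , inj ∘ vertex-injective , adj′⇒adj ∘ hom

attained? : ∀ n F → U.Decidable (Attained n F)
attained? n F m = map′
  (λ (s , free , e) → fromSubset n s , refl , free , e)
  (λ { (G , refl , free , e) →
       toSubset G , free ∘ ⊑-fromSubset G F , trans (edgeCount-fromSubset G) e })
  (anySubset? λ s → ¬? (F ⊑? fromSubset n s) ×-dec (edgeCount (fromSubset n s) ℕ.≟ m))

greatest : ∀ {ℓ} {P : ℕ → Set ℓ} → U.Decidable P → ℕ → ℕ
greatest P? zero = zero
greatest P? (suc b) with P? (suc b)
... | yes _ = suc b
... | no  _ = greatest P? b

module _ {ℓ} {P : ℕ → Set ℓ} (P? : U.Decidable P) where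

  greatest-upper : ∀ b {k} → P k → k ≤ b → k ≤ greatest P? b
  greatest-upper zero    p k≤b = k≤b
  greatest-upper (suc b) p k≤b with P? (suc b)
  ... | yes _ = k≤b
  ... | no ¬p with m≤n⇒m<n∨m≡n k≤b
  ...   | inj₁ k<b  = greatest-upper b p (≤-pred k<b)
  ...   | inj₂ refl = contradiction p ¬p

  greatest-attained : ∀ b {k} → P k → k ≤ b → P (greatest P? b)
  greatest-attained zero    p z≤n = p
  greatest-attained (suc b) p k≤b with P? (suc b)
  ... | yes q = q
  ... | no ¬p with m≤n⇒m<n∨m≡n k≤b
  ...   | inj₁ k<b  = greatest-attained b p (≤-pred k<b)
  ...   | inj₂ refl = contradiction p ¬p

-- If no graph on n vertices is F-free (which requires F to have no edges),
-- then ex n F = 0.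
ex : ℕ → Graph → ℕ
ex n F = greatest (attained? n F) (length (pairs n))

emptyGraph : ℕ → Graph
emptyGraph n = record
  { V = Fin n ; order = n ; enum = ↔-refl ; Adj = λ _ _ → ⊥
  ; _adj?_      = λ _ _ → no λ () ; symmetric = λ () ; irreflexive = λ _ () }

attained≤ : ∀ n F {m} → Attained n F m → m ≤ length (pairs n)
attained≤ _ _ (G , refl , _ , refl) = length-filter _ (pairs (order G))

ex-isTuránNumber : ∀ n F → HasEdge F → IsTuránNumber n F (ex n F)
ex-isTuránNumber n F (_ , _ , a) =
  greatest-attained (attained? n F) _ empty (attained≤ n F empty) ,
  λ k p → greatest-upper (attained? n F) _ p (attained≤ n F p)
  where
  empty : Attained n F (edgeCount (emptyGraph n))
  empty = emptyGraph n , refl , (λ (_ , _ , hom) → hom a) , refl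

fromℕℚ : ℕ → ℚ
fromℕℚ n = + n / 1

{-# OPTIONS --safe #-}
module Submission where

-- Lower bound: T □ S contains a 4-cycle, while the incidence graph of the
-- points (x , y) and the lines y = - m x - b over ℤ/p has 2p² vertices, p³ edges
-- and no 4-cycle. There is a prime in (x , 16x] for x = 4^j large: otherwise
-- every m ≤ 16x divides Z = (∏ of the primes ≤ x) (r !)^e with r = √(16x) and
-- 2^e = 16x, hence so does every entry of the first 16x rows of the Leibniz
-- harmonic triangle, and Z is smaller than the central one.
--
-- Upper bound: root the trees and map T □ S into G at random. The root goes to a
-- vertex with probability proportional to the degree; (t , root) to a uniform
-- neighbour of the image of (parent t , root), similarly for (root , s); and
-- (t , s) to a common neighbour v of the images of (t , parent s) and
-- (parent t , s), with probability proportional to 1 / deg v. The last step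
-- resamples the middle of a path of length two conditionally on its ends, so it
-- preserves the law of the stationary random walk. Therefore the images along
-- any staircase (towards the root in T, away from it in S) form a stationary
-- random walk. Stationarity bounds the expectations of 1 / deg and of the
-- inverse weighted codegree, hence the probability that two positions collide;
-- if G has more than C n^(3/2) edges, some outcome is injective.

-- Write D for the total degree of G. Stationarity bounds the expected inverse degree by n / D and
-- the expected inverse weighted codegree by n² / D, however irregular G is. A new inner position
-- hits the image v of an old one with probability at most min (1 , y z), where y is the inverse
-- degree of v and z the inverse codegree of the images of its parents. As y and z may be
-- correlated, the product is split into ℓ y + z / ℓ; with ℓ near the square root of n, both terms
-- are of order n^(3/2) / D in expectation. All expectations are kept multiplied by D. Since
-- `inv 0ℚ` is 0, the transition laws may lose mass where a degree or codegree vanishes. This is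
-- compatible with every upper bound, and is excluded only when an actual outcome is chosen.

open import Defs
open import Algebra.Bundles using (CommutativeRing)
open import Data.Fin as Fin using (Fin; zero; suc; toℕ)
import Data.Fin.Properties as Fin
import Data.Integer as ℤ
import Data.Integer.Properties as ℤ
open import Data.List using (List; []; _∷_; map; length; _++_)
import Data.List.Membership.DecPropositional as DecMembership
open import Data.List.Membership.Propositional using (_∈_; _∉_; find)
open import Data.List.Membership.Propositional.Properties
  using (∈-map⁺; ∈-map⁻; ∈-lookup; ∈-++⁻; ∈-++⁺ˡ; ∈-++⁺ʳ; ∈-filter⁺; ∈-allFin;
         ∈-cartesianProduct⁺; ∈-cartesianProductWith⁺; ∈-cartesianProductWith⁻)
open import Data.List.Relation.Unary.All as All using (All; []; _∷_)
open import Data.List.Relation.Unary.Any as Any using (here; there)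
open import Data.Nat as ℕ using (ℕ; zero; suc; z≤n; s≤s)
import Data.Nat.Properties as ℕ
open import Data.Nat.Primality using (Prime)
import Data.Nat.Solver
open import Data.Product using (∃; ∃₂; _×_; _,_; proj₁; proj₂)
open import Data.Product.Properties using (,-injectiveˡ; ,-injectiveʳ)
import Data.Rational.Unnormalised as ℚᵘ
import Data.Rational.Unnormalised.Properties as ℚᵘ
open import Data.Sum as Sum using (_⊎_; inj₁; inj₂)
open import Function using (_∘_; id)
open import Function.Definitions using (Injective)
open import Relation.Binary using (Decidable; Symmetric; DecidableEquality)
open import Relation.Binary.PropositionalEquality
open import Relation.Nullary using (¬_; Dec; yes; no; contradiction)
import Relation.Unary as U

-- Finite sums of rationals, and a total inverse.

module RationalSums where
  open import Data.Rational as ℚ hiding (_≟_)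
  open import Data.Rational.Properties as ℚ hiding (_≟_)
  open import Algebra.Properties.Semiring.Sum (CommutativeRing.semiring +-*-commutativeRing) public
    using (sum; sum-cong-≗; ∑-distrib-+; ∑-comm; *-distribˡ-sum; *-distribʳ-sum)
  open import Relation.Nullary.Decidable using (_×-dec_; ¬?)

  *-mono-≤ˡ : ∀ {r p q} → 0ℚ ≤ r → p ≤ q → r * p ≤ r * q
  *-mono-≤ˡ {r} 0≤r = *-monoˡ-≤-nonNeg r {{nonNegative 0≤r}}

  *-mono-≤ʳ : ∀ {r p q} → 0ℚ ≤ r → p ≤ q → p * r ≤ q * r
  *-mono-≤ʳ {r} 0≤r = *-monoʳ-≤-nonNeg r {{nonNegative 0≤r}}

  0≤* : ∀ {p q} → 0ℚ ≤ p → 0ℚ ≤ q → 0ℚ ≤ p * q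
  0≤* {p} {q} 0≤p 0≤q = subst (_≤ p * q) (*-zeroʳ p) (*-mono-≤ˡ 0≤p 0≤q)

  0≤+ : ∀ {p q} → 0ℚ ≤ p → 0ℚ ≤ q → 0ℚ ≤ p + q
  0≤+ = +-mono-≤

  p≤p+q : ∀ {p q} → 0ℚ ≤ q → p ≤ p + q
  p≤p+q {p} {q} 0≤q = subst (_≤ p + q) (+-identityʳ p) (+-monoʳ-≤ p 0≤q)

  q≤p+q : ∀ {p q} → 0ℚ ≤ p → q ≤ p + q
  q≤p+q {p} {q} 0≤p = subst (_≤ p + q) (+-identityˡ q) (+-monoˡ-≤ q 0≤p)

  ≤1⇒*≤ : ∀ {p q} → 0ℚ ≤ p → q ≤ 1ℚ → p * q ≤ p
  ≤1⇒*≤ {p} {q} 0≤p q≤1 = subst (p * q ≤_) (*-identityʳ p) (*-mono-≤ˡ 0≤p q≤1)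

  inv : ℚ → ℚ
  inv q with q ℚ.≟ 0ℚ
  ... | yes _  = 0ℚ
  ... | no q≢0 = (1/ q) {{≢-nonZero q≢0}}

  inv-nonneg : ∀ {q} → 0ℚ ≤ q → 0ℚ ≤ inv q
  inv-nonneg {q} 0≤q with q ℚ.≟ 0ℚ
  ... | yes _  = ≤-refl
  ... | no q≢0 = <⇒≤ (positive⁻¹ _ {{1/pos⇒pos q {{q>0}}}})
    where
    q>0 : Positive q
    q>0 = nonNeg∧nonZero⇒pos q {{nonNegative 0≤q}} {{≢-nonZero q≢0}}

  *-inv : ∀ {q} → q ≢ 0ℚ → q * inv q ≡ 1ℚ
  *-inv {q} q≢0 with q ℚ.≟ 0ℚ
  ... | yes q≡0 = contradiction q≡0 q≢0
  ... | no q≢0′ = *-inverseʳ q {{≢-nonZero q≢0′}}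

  inv≢0 : ∀ {z} → z ≢ 0ℚ → inv z ≢ 0ℚ
  inv≢0 {z} z≢0 iz≡0 = 1≢0 (trans (sym (*-inv z≢0)) (trans (cong (z *_) iz≡0) (*-zeroʳ z)))

  0≤1 : 0ℚ ≤ 1ℚ
  0≤1 = nonNegative⁻¹ 1ℚ

  *-inv≤1 : ∀ q → q * inv q ≤ 1ℚ
  *-inv≤1 q with q ℚ.≟ 0ℚ
  ... | yes q≡0 = subst (_≤ 1ℚ) (sym (*-zeroʳ q)) 0≤1
  ... | no q≢0  = ≤-reflexive (*-inverseʳ q {{≢-nonZero q≢0}})

  sum-mono : ∀ {n} {f g : Fin n → ℚ} → (∀ i → f i ≤ g i) → sum f ≤ sum g
  sum-mono {zero}  f≤g = ≤-refl
  sum-mono {suc n} f≤g = +-mono-≤ (f≤g zero) (sum-mono λ i → f≤g (suc i))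

  sum-nonneg : ∀ {n} {f : Fin n → ℚ} → (∀ i → 0ℚ ≤ f i) → 0ℚ ≤ sum f
  sum-nonneg {zero}  0≤f = ≤-refl
  sum-nonneg {suc n} 0≤f = 0≤+ (0≤f zero) (sum-nonneg λ i → 0≤f (suc i))

  term≤sum : ∀ {n} {f : Fin n → ℚ} → (∀ i → 0ℚ ≤ f i) → ∀ i → f i ≤ sum f
  term≤sum {suc n} 0≤f zero    = p≤p+q (sum-nonneg λ i → 0≤f (suc i))
  term≤sum {suc n} 0≤f (suc i) = ≤-trans (term≤sum (λ i → 0≤f (suc i)) i) (q≤p+q (0≤f zero))

  *≢0ˡ : ∀ y {z} → y * z ≢ 0ℚ → y ≢ 0ℚ
  *≢0ˡ _ {z} yz≢0 refl = yz≢0 (*-zeroˡ z)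

  *≢0ʳ : ∀ y {z} → y * z ≢ 0ℚ → z ≢ 0ℚ
  *≢0ʳ y yz≢0 refl = yz≢0 (*-zeroʳ y)

  -- The embedding of ℕ in ℚ, opaque since normalising fromℕℚ on open terms
  -- unfolds the computation of a gcd.
  abstract
    ι : ℕ → ℚ
    ι = fromℕℚ

    ι≡fromℕℚ : ∀ n → ι n ≡ fromℕℚ n
    ι≡fromℕℚ n = refl

    ι-0 : ι 0 ≡ 0ℚ
    ι-0 = refl

    ι-1 : ι 1 ≡ 1ℚ
    ι-1 = refl

    toℚᵘ-ι : ∀ n → ℚ.toℚᵘ (ι n) ℚᵘ.≃ ℚᵘ.mkℚᵘ (ℤ.+ n) 0
    toℚᵘ-ι n = toℚᵘ-fromℚᵘ (ℚᵘ.mkℚᵘ (ℤ.+ n) 0)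

    ι-+ : ∀ m n → ι (m ℕ.+ n) ≡ ι m + ι n
    ι-+ m n = toℚᵘ-injective (begin
      ℚ.toℚᵘ (ι (m ℕ.+ n))                     ≈⟨ toℚᵘ-ι (m ℕ.+ n) ⟩
      ℚᵘ.mkℚᵘ (ℤ.+ (m ℕ.+ n)) 0                  ≈⟨ ℚᵘ.*≡* (cong (ℤ._* ℤ.+ 1) (cong₂ ℤ._+_ (sym (ℤ.*-identityʳ (ℤ.+ m))) (sym (ℤ.*-identityʳ (ℤ.+ n))))) ⟩
      ℚᵘ.mkℚᵘ (ℤ.+ m) 0 ℚᵘ.+ ℚᵘ.mkℚᵘ (ℤ.+ n) 0   ≈⟨ ℚᵘ.+-cong (toℚᵘ-ι m) (toℚᵘ-ι n) ⟨
      ℚ.toℚᵘ (ι m) ℚᵘ.+ ℚ.toℚᵘ (ι n)             ≈⟨ toℚᵘ-homo-+ (ι m) (ι n) ⟨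
      ℚ.toℚᵘ (ι m + ι n) ∎)
      where open ℚᵘ.≃-Reasoning

    ι-suc : ∀ n → ι (suc n) ≡ 1ℚ + ι n
    ι-suc n = ι-+ 1 n

    ι-* : ∀ m n → ι (m ℕ.* n) ≡ ι m * ι n
    ι-* zero    n = sym (*-zeroˡ (ι n))
    ι-* (suc m) n = begin
      ι (n ℕ.+ m ℕ.* n)    ≡⟨ ι-+ n (m ℕ.* n) ⟩
      ι n + ι (m ℕ.* n)    ≡⟨ cong₂ _+_ (sym (*-identityˡ (ι n))) (ι-* m n) ⟩
      1ℚ * ι n + ι m * ι n ≡⟨ *-distribʳ-+ (ι n) 1ℚ (ι m) ⟨
      (1ℚ + ι m) * ι n     ≡⟨ cong (_* ι n) (ι-suc m) ⟨
      ι (suc m) * ι n ∎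
      where open ≡-Reasoning

    ι-nonneg : ∀ n → 0ℚ ≤ ι n
    ι-nonneg zero    = ≤-refl
    ι-nonneg (suc n) = subst (0ℚ ≤_) (sym (ι-suc n)) (0≤+ 0≤1 (ι-nonneg n))

    ι-mono : ∀ {m n} → m ℕ.≤ n → ι m ≤ ι n
    ι-mono {m} {n} m≤n = subst (ι m ≤_)
      (trans (sym (ι-+ m (n ℕ.∸ m))) (cong ι (ℕ.m+[n∸m]≡n m≤n)))
      (p≤p+q (ι-nonneg (n ℕ.∸ m)))

    ι-mono-< : ∀ {m n} → m ℕ.< n → ι m < ι n
    ι-mono-< {m} m<n = <-≤-trans
      (subst (ι m <_) (sym (ι-suc m))
        (subst (_< 1ℚ + ι m) (+-identityˡ _) (+-monoˡ-< (ι m) (positive⁻¹ 1ℚ))))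
      (ι-mono m<n)

  ι-≢0 : ∀ {n} → 1 ℕ.≤ n → ι n ≢ 0ℚ
  ι-≢0 {n} 1≤n eq = <-irrefl (sym eq) (<-≤-trans (positive⁻¹ 1ℚ) (subst (_≤ ι n) ι-1 (ι-mono 1≤n)))

  ≤∧≢⇒< : ∀ {q} → 0ℚ ≤ q → q ≢ 0ℚ → 0ℚ < q
  ≤∧≢⇒< 0≤q q≢0 = ≰⇒> λ q≤0 → q≢0 (≤-antisym q≤0 0≤q)

  -- Were `f i` at least 1 wherever `c i` is nonzero, the weighted sum would reach `sum c`. The
  -- nonzero weight of the index found is what later yields adjacency.
  sum-witness : ∀ {n} (c f : Fin n → ℚ) → (∀ i → 0ℚ ≤ c i) →
                sum (λ i → c i * f i) < sum c → ∃ λ i → c i ≢ 0ℚ × f i < 1ℚ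
  sum-witness c f 0≤c avg<1 with Fin.any? (λ i → ¬? (c i ℚ.≟ 0ℚ) ×-dec (f i <? 1ℚ))
  ... | yes found = found
  ... | no ¬found = contradiction avg<1 (≤⇒≯ (sum-mono c≤cf))
    where
    ≤⇒≯ : ∀ {p q} → p ≤ q → ¬ (q < p)
    ≤⇒≯ p≤q q<p = <-irrefl refl (<-≤-trans q<p p≤q)
    c≤cf : ∀ i → c i ≤ c i * f i
    c≤cf i with c i ℚ.≟ 0ℚ
    ... | yes ci≡0 = ≤-reflexive (trans ci≡0 (sym (trans (cong (_* f i) ci≡0) (*-zeroˡ (f i)))))
    ... | no ci≢0  = subst (_≤ c i * f i) (*-identityʳ (c i))
      (*-mono-≤ˡ (0≤c i) (≮⇒≥ λ fi<1 → ¬found (i , ci≢0 , fi<1)))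

  δ : ∀ {n} → Fin n → Fin n → ℚ
  δ i j with i Fin.≟ j
  ... | yes _ = 1ℚ
  ... | no  _ = 0ℚ

  δ-nonneg : ∀ {n} (i j : Fin n) → 0ℚ ≤ δ i j
  δ-nonneg i j with i Fin.≟ j
  ... | yes _ = 0≤1
  ... | no  _ = ≤-refl

  δ-refl : ∀ {n} (i : Fin n) → δ i i ≡ 1ℚ
  δ-refl i with i Fin.≟ i
  ... | yes _  = refl
  ... | no i≢i = contradiction refl i≢i

  sum-zero : ∀ {n} {f : Fin n → ℚ} → (∀ i → f i ≡ 0ℚ) → sum f ≡ 0ℚ
  sum-zero {zero}  f≡0 = refl
  sum-zero {suc n} f≡0 = cong₂ _+_ (f≡0 zero) (sum-zero λ i → f≡0 (suc i))

  sum-δ : ∀ {n} (f : Fin n → ℚ) j → sum (λ i → f i * δ i j) ≡ f j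
  sum-δ {suc n} f zero = trans
    (cong₂ _+_ (*-identityʳ (f zero)) (sum-zero λ i → *-zeroʳ (f (suc i)))) (+-identityʳ _)
  sum-δ {suc n} f (suc j) = trans
    (cong₂ _+_ (*-zeroʳ (f zero)) (trans (sum-cong-≗ (λ i → cong (f (suc i) *_) (δ-suc i))) (sum-δ (λ i → f (suc i)) j)))
    (+-identityˡ _)
    where
    δ-suc : ∀ i → δ (Fin.suc i) (suc j) ≡ δ i j
    δ-suc i with i Fin.≟ j
    ... | yes _ = refl
    ... | no  _ = refl

  sum-const : ∀ n z → sum {n} (λ _ → z) ≡ ι n * z
  sum-const zero    z = trans (sym (*-zeroˡ z)) (cong (_* z) (sym ι-0))
  sum-const (suc n) z = begin
    z + sum {n} (λ _ → z)    ≡⟨ cong₂ _+_ (sym (*-identityˡ z)) (sum-const n z) ⟩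
    1ℚ * z + ι n * z    ≡⟨ *-distribʳ-+ z 1ℚ (ι n) ⟨
    (1ℚ + ι n) * z      ≡⟨ cong (_* z) (ι-suc n) ⟨
    ι (suc n) * z ∎
    where open ≡-Reasoning

-- The stationary random walk on a graph.

module RandomWalk {n} {_~_ : Fin n → Fin n → Set} (_~?_ : Decidable _~_) (~-sym : Symmetric _~_) where
  open RationalSums
  open import Data.Rational as ℚ hiding (_≟_)
  open import Data.Rational.Properties as ℚ hiding (_≟_)
  open import Data.Rational.Solver using (module +-*-Solver)

  a : Fin n → Fin n → ℚ
  a u v with u ~? v
  ... | yes _ = 1ℚ
  ... | no  _ = 0ℚ

  a-nonneg : ∀ u v → 0ℚ ≤ a u v
  a-nonneg u v with u ~? v
  ... | yes _ = 0≤1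
  ... | no  _ = ≤-refl

  a≤1 : ∀ u v → a u v ≤ 1ℚ
  a≤1 u v with u ~? v
  ... | yes _ = ≤-refl
  ... | no  _ = 0≤1

  a-adj : ∀ {u v} → u ~ v → a u v ≡ 1ℚ
  a-adj {u} {v} u~v with u ~? v
  ... | yes _  = refl
  ... | no u≁v = contradiction u~v u≁v

  adj-a : ∀ {u v} → a u v ≢ 0ℚ → u ~ v
  adj-a {u} {v} auv≢0 with u ~? v
  ... | yes u~v = u~v
  ... | no  _   = contradiction refl auv≢0

  a-sym : ∀ u v → a u v ≡ a v u
  a-sym u v with u ~? v | v ~? u
  ... | yes _   | yes _   = refl
  ... | no  _   | no  _   = refl
  ... | yes u~v | no v≁u  = contradiction (~-sym u~v) v≁u
  ... | no  u≁v | yes v~u = contradiction (~-sym v~u) u≁v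

  -- d is the degree, k the transition matrix of the random walk, w the codegree
  -- weighted by inverse degrees, and κ u c the law of the middle vertex of a
  -- stationary walk of length two from u to c.

  d : Fin n → ℚ
  d u = sum (a u)

  k : Fin n → Fin n → ℚ
  k u v = a u v * inv (d u)

  w : Fin n → Fin n → ℚ
  w u c = sum λ b → a u b * k b c

  κ : Fin n → Fin n → Fin n → ℚ
  κ u c v = a u v * k v c * inv (w u c)

  d-nonneg : ∀ u → 0ℚ ≤ d u
  d-nonneg u = sum-nonneg (a-nonneg u)

  k-nonneg : ∀ u v → 0ℚ ≤ k u v
  k-nonneg u v = 0≤* (a-nonneg u v) (inv-nonneg (d-nonneg u))

  w-nonneg : ∀ u c → 0ℚ ≤ w u c
  w-nonneg u c = sum-nonneg λ b → 0≤* (a-nonneg u b) (k-nonneg b c)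

  κ-nonneg : ∀ u c v → 0ℚ ≤ κ u c v
  κ-nonneg u c v = 0≤* (0≤* (a-nonneg u v) (k-nonneg v c)) (inv-nonneg (w-nonneg u c))

  sum-k : ∀ u → sum (k u) ≡ d u * inv (d u)
  sum-k u = sym (*-distribʳ-sum (inv (d u)) (a u))

  sum-κ : ∀ u c → sum (κ u c) ≡ w u c * inv (w u c)
  sum-κ u c = sym (*-distribʳ-sum (inv (w u c)) (λ b → a u b * k b c))

  sum-k≤1 : ∀ u → sum (k u) ≤ 1ℚ
  sum-k≤1 u = subst (_≤ 1ℚ) (sym (sum-k u)) (*-inv≤1 (d u))

  sum-κ≤1 : ∀ u c → sum (κ u c) ≤ 1ℚ
  sum-κ≤1 u c = subst (_≤ 1ℚ) (sym (sum-κ u c)) (*-inv≤1 (w u c))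

  d≢0 : ∀ {u v} → u ~ v → d u ≢ 0ℚ
  d≢0 {u} {v} u~v du≡0 = <-irrefl refl
    (<-≤-trans (positive⁻¹ 1ℚ) (subst₂ _≤_ (a-adj u~v) du≡0 (term≤sum (a-nonneg u) v)))

  d*k : ∀ u v → d u * k u v ≡ a u v
  d*k u v with u ~? v
  ... | no _ = trans (cong (d u *_) (*-zeroˡ (inv (d u)))) (*-zeroʳ (d u))
  ... | yes u~v = trans (cong (d u *_) (*-identityˡ (inv (d u)))) (*-inv (d≢0 u~v))

  -- Associativity of the product of a row vector, a matrix and a column vector; it regroups a
  -- two-step average by its end vertex.
  sum-assoc : ∀ (x : Fin n → ℚ) (y : Fin n → Fin n → ℚ) (h : Fin n → ℚ) →
              sum (λ b → x b * sum (λ c → y b c * h c)) ≡ sum (λ c → sum (λ b → x b * y b c) * h c)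
  sum-assoc x y h = begin
    sum (λ b → x b * sum (λ c → y b c * h c))
      ≡⟨ sum-cong-≗ (λ b → trans (*-distribˡ-sum (x b) (λ c → y b c * h c))
           (sum-cong-≗ λ c → sym (*-assoc (x b) (y b c) (h c)))) ⟩
    sum (λ b → sum (λ c → x b * y b c * h c))
      ≡⟨ ∑-comm (λ b c → x b * y b c * h c) ⟩
    sum (λ c → sum (λ b → x b * y b c * h c))
      ≡⟨ sum-cong-≗ (λ c → sym (*-distribʳ-sum (h c) (λ b → x b * y b c))) ⟩
    sum (λ c → sum (λ b → x b * y b c) * h c) ∎
    where open ≡-Reasoning

  -- R v l f is the average of f over walks of length l from v (v excluded),
  -- and π l f that over stationary walks of length l, multiplied by the total
  -- degree.
  R : Fin n → ℕ → (List (Fin n) → ℚ) → ℚ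
  R v zero    f = f []
  R v (suc l) f = sum λ u → k v u * R u l (λ us → f (u ∷ us))

  π : ℕ → (List (Fin n) → ℚ) → ℚ
  π l f = sum λ v → d v * R v l (λ us → f (v ∷ us))

  R-nonneg : ∀ l v {f} → (∀ us → 0ℚ ≤ f us) → 0ℚ ≤ R v l f
  R-nonneg zero    v 0≤f = 0≤f []
  R-nonneg (suc l) v 0≤f = sum-nonneg λ u → 0≤* (k-nonneg v u) (R-nonneg l u λ us → 0≤f (u ∷ us))

  R-const : ∀ l v {x} → 0ℚ ≤ x → R v l (λ _ → x) ≤ x
  R-const zero    v 0≤x = ≤-refl
  R-const (suc l) v {x} 0≤x = begin
    sum (λ u → k v u * R u l (λ _ → x)) ≤⟨ sum-mono (λ u → *-mono-≤ˡ (k-nonneg v u) (R-const l u 0≤x)) ⟩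
    sum (λ u → k v u * x)               ≡⟨ sym (*-distribʳ-sum x (k v)) ⟩
    sum (k v) * x                       ≤⟨ *-mono-≤ʳ 0≤x (sum-k≤1 v) ⟩
    1ℚ * x                              ≡⟨ *-identityˡ x ⟩
    x                                   ∎
    where open ≤-Reasoning

  R-sum : ∀ l v (x : Fin n → ℚ) (g : Fin n → List (Fin n) → ℚ) →
          R v l (λ us → sum λ i → x i * g i us) ≡ sum λ i → x i * R v l (g i)
  R-sum zero    v x g = refl
  R-sum (suc l) v x g = begin
    sum (λ u → k v u * R u l (λ us → sum λ i → x i * g i (u ∷ us)))
      ≡⟨ sum-cong-≗ (λ u → cong (k v u *_) (trans (R-sum l u x (λ i us → g i (u ∷ us)))
           (sum-cong-≗ λ i → *-comm (x i) _))) ⟩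
    sum (λ u → k v u * sum (λ i → G u i * x i))
      ≡⟨ sum-assoc (k v) G x ⟩
    sum (λ i → sum (λ u → k v u * G u i) * x i)
      ≡⟨ sum-cong-≗ (λ i → *-comm _ (x i)) ⟩
    sum (λ i → x i * sum (λ u → k v u * G u i)) ∎
    where
    open ≡-Reasoning
    G : Fin n → Fin n → ℚ
    G u i = R u l (λ us → g i (u ∷ us))

  -- The walk runs from `u` through `b` to `c`; the entry `b` is discarded and redrawn from `κ u c`.
  flip : Fin n → (List (Fin n) → ℚ) → List (Fin n) → ℚ
  flip u g (b ∷ c ∷ r) = sum λ v → κ u c v * g (v ∷ c ∷ r)
  flip u g _           = 0ℚ

  -- Resampling an inner vertex of a walk conditionally on the other vertices.
  R-flip : ∀ l u {g} → (∀ us → 0ℚ ≤ g us) → R u (2 ℕ.+ l) (flip u g) ≤ R u (2 ℕ.+ l) g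
  R-flip l u {g} 0≤g = begin
    sum (λ b → k u b * sum (λ c → k b c * R c l (λ r → sum λ v → κ u c v * g (v ∷ c ∷ r))))
      ≡⟨ sum-cong-≗ (λ b → cong (k u b *_) (sum-cong-≗ λ c → cong (k b c *_)
           (R-sum l c (κ u c) (λ v r → g (v ∷ c ∷ r))))) ⟩
    sum (λ b → k u b * sum (λ c → k b c * sum (λ v → κ u c v * G c v)))
      ≡⟨ sum-assoc (k u) k (λ c → sum (λ v → κ u c v * G c v)) ⟩
    sum (λ c → sum (λ b → k u b * k b c) * sum (λ v → κ u c v * G c v))
      ≤⟨ sum-mono flip-at ⟩
    sum (λ c → sum (λ v → k u v * (k v c * G c v)))
      ≡⟨ ∑-comm (λ c v → k u v * (k v c * G c v)) ⟩
    sum (λ v → sum (λ c → k u v * (k v c * G c v)))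
      ≡⟨ sum-cong-≗ (λ v → sym (*-distribˡ-sum (k u v) (λ c → k v c * G c v))) ⟩
    sum (λ v → k u v * sum (λ c → k v c * G c v)) ∎
    where
    open ≤-Reasoning
    G : Fin n → Fin n → ℚ
    G c v = R c l (λ r → g (v ∷ c ∷ r))

    G-nonneg : ∀ c v → 0ℚ ≤ G c v
    G-nonneg c v = R-nonneg l c λ r → 0≤g (v ∷ c ∷ r)

    open +-*-Solver
    rearrange : ∀ iu W x y iw z →
                (iu * W) * ((x * y * iw) * z) ≡ ((x * iu) * (y * z)) * (W * iw)
    rearrange = solve 6 (λ iu W x y iw z →
      (iu :* W) :* ((x :* y :* iw) :* z) := ((x :* iu) :* (y :* z)) :* (W :* iw)) refl

    two-step : ∀ c → sum (λ b → k u b * k b c) ≡ inv (d u) * w u c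
    two-step c = trans
      (sum-cong-≗ λ b → trans (cong (_* k b c) (*-comm (a u b) (inv (d u)))) (*-assoc (inv (d u)) (a u b) (k b c)))
      (sym (*-distribˡ-sum (inv (d u)) (λ b → a u b * k b c)))

    -- Two steps from `u` reach `c` with weight `inv (d u) * w u c`, and this `w u c` cancels the
    -- normalisation of `κ`, up to a factor of at most 1.
    flip-at : ∀ c → sum (λ b → k u b * k b c) * sum (λ v → κ u c v * G c v) ≤
                    sum (λ v → k u v * (k v c * G c v))
    flip-at c = begin
      sum (λ b → k u b * k b c) * sum (λ v → κ u c v * G c v)
        ≡⟨ cong (_* sum (λ v → κ u c v * G c v)) (two-step c) ⟩
      inv (d u) * w u c * sum (λ v → κ u c v * G c v)
        ≡⟨ *-distribˡ-sum (inv (d u) * w u c) (λ v → κ u c v * G c v) ⟩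
      sum (λ v → inv (d u) * w u c * (κ u c v * G c v))
        ≡⟨ sum-cong-≗ (λ v → rearrange (inv (d u)) (w u c) (a u v) (k v c) (inv (w u c)) (G c v)) ⟩
      sum (λ v → k u v * (k v c * G c v) * (w u c * inv (w u c)))
        ≤⟨ sum-mono (λ v → ≤1⇒*≤ (0≤* (k-nonneg u v) (0≤* (k-nonneg v c) (G-nonneg c v))) (*-inv≤1 (w u c))) ⟩
      sum (λ v → k u v * (k v c * G c v)) ∎

  prepend : (List (Fin n) → ℚ) → List (Fin n) → ℚ
  prepend g (b ∷ r) = sum λ v → k b v * g (v ∷ b ∷ r)
  prepend g []      = 0ℚ

  detailed-balance : ∀ u v → d u * k u v ≡ d v * k v u
  detailed-balance u v = trans (d*k u v) (trans (a-sym u v) (sym (d*k v u)))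

  -- Reversibility: by `detailed-balance`, the first edge of a stationary walk may be drawn from
  -- either end.
  sum-balance : ∀ (G : Fin n → Fin n → ℚ) →
                sum (λ b → d b * sum (λ v → k b v * G v b)) ≡ sum (λ v → d v * sum (λ b → k v b * G v b))
  sum-balance G = begin
    sum (λ b → d b * sum (λ v → k b v * G v b))
      ≡⟨ sum-cong-≗ (λ b → *-distribˡ-sum (d b) (λ v → k b v * G v b)) ⟩
    sum (λ b → sum (λ v → d b * (k b v * G v b)))
      ≡⟨ ∑-comm (λ b v → d b * (k b v * G v b)) ⟩
    sum (λ v → sum (λ b → d b * (k b v * G v b)))
      ≡⟨ sum-cong-≗ (λ v → sum-cong-≗ λ b → balance v b) ⟩
    sum (λ v → sum (λ b → d v * (k v b * G v b)))
      ≡⟨ sum-cong-≗ (λ v → sym (*-distribˡ-sum (d v) (λ b → k v b * G v b))) ⟩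
    sum (λ v → d v * sum (λ b → k v b * G v b)) ∎
    where
    open ≡-Reasoning
    balance : ∀ v b → d b * (k b v * G v b) ≡ d v * (k v b * G v b)
    balance v b = trans (sym (*-assoc (d b) (k b v) (G v b)))
      (trans (cong (_* G v b) (detailed-balance b v)) (*-assoc (d v) (k v b) (G v b)))

  π-prepend : ∀ l g → π l (prepend g) ≡ π (suc l) g
  π-prepend l g = trans
    (sum-cong-≗ λ b → cong (d b *_) (R-sum l b (k b) (λ v r → g (v ∷ b ∷ r))))
    (sum-balance λ v b → R b l (λ r → g (v ∷ b ∷ r)))

  afterHead : (List (Fin n) → ℚ) → List (Fin n) → ℚ
  afterHead g (_ ∷ r) = g r
  afterHead g []      = 0ℚ

  π-afterHead : ∀ l {g} → (∀ us → 0ℚ ≤ g us) → π (suc l) (afterHead g) ≤ π l g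
  π-afterHead l {g} 0≤g = begin
    sum (λ v → d v * sum (λ b → k v b * G b))
      ≡⟨ sym (sum-balance λ _ b → G b) ⟩
    sum (λ b → d b * sum (λ v → k b v * G b))
      ≡⟨ sum-cong-≗ (λ b → cong (d b *_) (trans (sym (*-distribʳ-sum (G b) (k b))) (*-comm _ (G b)))) ⟩
    sum (λ b → d b * (G b * sum (k b)))
      ≤⟨ sum-mono (λ b → *-mono-≤ˡ (d-nonneg b) (≤1⇒*≤ (R-nonneg l b λ r → 0≤g (b ∷ r)) (sum-k≤1 b))) ⟩
    sum (λ b → d b * G b) ∎
    where
    open ≤-Reasoning
    G : Fin n → ℚ
    G b = R b l (λ r → g (b ∷ r))

  inv-d-head : List (Fin n) → ℚ
  inv-d-head (v ∷ _) = inv (d v)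
  inv-d-head []      = 0ℚ

  inv-d-head-nonneg : ∀ us → 0ℚ ≤ inv-d-head us
  inv-d-head-nonneg (v ∷ _) = inv-nonneg (d-nonneg v)
  inv-d-head-nonneg []      = ≤-refl

  π-inv-d : ∀ l → π l inv-d-head ≤ sum {n} (λ _ → 1ℚ)
  π-inv-d l = sum-mono λ v → ≤-trans
    (*-mono-≤ˡ (d-nonneg v) (R-const l v (inv-nonneg (d-nonneg v)))) (*-inv≤1 (d v))

  inv-w-cherry : List (Fin n) → ℚ
  inv-w-cherry (u ∷ _ ∷ c ∷ _) = inv (w u c)
  inv-w-cherry _               = 0ℚ

  inv-w-cherry-nonneg : ∀ us → 0ℚ ≤ inv-w-cherry us
  inv-w-cherry-nonneg (u ∷ _ ∷ c ∷ _) = inv-nonneg (w-nonneg u c)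
  inv-w-cherry-nonneg []          = ≤-refl
  inv-w-cherry-nonneg (_ ∷ [])    = ≤-refl
  inv-w-cherry-nonneg (_ ∷ _ ∷ []) = ≤-refl

  -- The ends `u` and `c` of a two-step walk occur with weight `w u c`, so each of the n² pairs
  -- contributes at most `w u c * inv (w u c)`, hence at most 1.
  π-inv-w : ∀ l → π (2 ℕ.+ l) inv-w-cherry ≤ sum {n} (λ _ → sum {n} λ _ → 1ℚ)
  π-inv-w l = sum-mono λ u → begin
    d u * sum (λ b → k u b * sum (λ c → k b c * R c l (λ _ → inv (w u c))))
      ≤⟨ *-mono-≤ˡ (d-nonneg u) (sum-mono λ b → *-mono-≤ˡ (k-nonneg u b)
           (sum-mono λ c → *-mono-≤ˡ (k-nonneg b c) (R-const l c (inv-nonneg (w-nonneg u c))))) ⟩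
    d u * sum (λ b → k u b * sum (λ c → k b c * inv (w u c)))
      ≡⟨ *-distribˡ-sum (d u) (λ b → k u b * sum (λ c → k b c * inv (w u c))) ⟩
    sum (λ b → d u * (k u b * sum (λ c → k b c * inv (w u c))))
      ≡⟨ sum-cong-≗ (λ b → trans (sym (*-assoc (d u) (k u b) _)) (cong (_* sum (λ c → k b c * inv (w u c))) (d*k u b))) ⟩
    sum (λ b → a u b * sum (λ c → k b c * inv (w u c)))
      ≡⟨ sum-assoc (a u) k (λ c → inv (w u c)) ⟩
    sum (λ c → w u c * inv (w u c))
      ≤⟨ sum-mono (λ c → *-inv≤1 (w u c)) ⟩
    sum {n} (λ _ → 1ℚ) ∎
    where open ≤-Reasoning

-- Random maps of a product of two rooted trees.

module RandomGrid where
  open RationalSums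
  open import Data.Rational as ℚ hiding (_≟_)
  open import Data.Rational.Properties as ℚ hiding (_≟_)
  open import Data.List.Properties using (≡-dec)
  import Data.Product.Properties as Prod
  open import Data.Rational.Solver using (module +-*-Solver)

  -- A vertex of a rooted tree is the list of labels on its path to the root, so
  -- that its parent is its tail.
  Node : Set
  Node = List ℕ

  Pos : Set
  Pos = Node × Node

  _≟_ : DecidableEquality Pos
  _≟_ = Prod.≡-dec (≡-dec ℕ._≟_) (≡-dec ℕ._≟_)

  infix 4 _◁_ _≟_

  data _◁_ : Pos → Pos → Set where
    left  : ∀ {i t s} → (t , s) ◁ (i ∷ t , s)
    right : ∀ {j t s} → (t , s) ◁ (t , j ∷ s)

  -- An order of sampling, the latest position at the head: the parents of a position (one on the
  -- border, two inside) are drawn before it.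
  data Ordered : List Pos → Set where
    root   : Ordered (([] , []) ∷ [])
    extend : ∀ {q C} → Ordered C → q ∉ C → (∀ {p} → p ◁ q → p ∈ C) → Ordered (q ∷ C)

  root∈ : ∀ {C} → Ordered C → ([] , []) ∈ C
  root∈ root           = here refl
  root∈ (extend o _ _) = there (root∈ o)

  closed : ∀ {C p q} → Ordered C → q ∈ C → p ◁ q → p ∈ C
  closed root             (here refl) ()
  closed (extend o _ par) (here refl) p◁q = there (par p◁q)
  closed (extend o _ _)   (there q∈)  p◁q = there (closed o q∈ p◁q)

  strengthen : ∀ {C : List Pos} {p q} → p ∈ q ∷ C → p ≢ q → p ∈ C
  strengthen (here p≡q) p≢q = contradiction p≡q p≢q
  strengthen (there p∈) _   = p∈

  -- Q lists a staircase from (t , s), without (t , s) itself.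
  data Stair : Node → Node → List Pos → Set where
    done : ∀ {s} → Stair [] s []
    down : ∀ {i t s Q} → Stair t s Q → Stair (i ∷ t) s ((t , s) ∷ Q)
    up   : ∀ {j t s Q} → Stair t (j ∷ s) Q → Stair t s ((t , j ∷ s) ∷ Q)

  stair-length : ∀ {t s Q} → Stair t s Q → All (λ p → length (proj₁ p) ℕ.≤ length t) Q
  stair-length done     = []
  stair-length (down σ) = ℕ.n≤1+n _ ∷ All.map ℕ.m≤n⇒m≤1+n (stair-length σ)
  stair-length (up σ)   = ℕ.≤-refl ∷ stair-length σ

  -- The first coordinate never gets longer along a staircase, so no position one level deeper
  -- occurs on it.
  stair-fresh : ∀ {i t t′ s s′ Q} → Stair t s′ Q → length t ≡ length t′ → All (_≢ (i ∷ t′ , s)) Q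
  stair-fresh {t′ = t′} σ eq = All.map
    (λ { {p} le refl → ℕ.<-irrefl refl (subst (suc (length t′) ℕ.≤_) eq le) }) (stair-length σ)

  -- Going straight down to the root of the first tree passes through parents only and so stays in
  -- `C`. Hence every position of `C` starts a staircase inside `C`.
  stair-column : ∀ {C} → Ordered C → ∀ t s → (t , s) ∈ C → ∃ λ Q → Stair t s Q × All (_∈ C) Q
  stair-column o []      s _  = [] , done , []
  stair-column o (i ∷ t) s p∈ with closed o p∈ left
  ... | p′∈ with stair-column o t s p′∈
  ...   | Q , σ , Q⊆C = _ , down σ , p′∈ ∷ Q⊆C

  module _ {n} {_~_ : Fin n → Fin n → Set} (_~?_ : Decidable _~_) (~-sym : Symmetric _~_) where
    open RandomWalk _~?_ ~-sym

    State : Set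
    State = Pos → Fin n

    infixl 8 _[_↦_]

    -- Opaque, so that case splits on _≟_ leave updates in goals alone.
    abstract
      _[_↦_] : State → Pos → Fin n → State
      (x [ q ↦ v ]) p with p ≟ q
      ... | yes _ = v
      ... | no  _ = x p

      update-self : ∀ x q v → (x [ q ↦ v ]) q ≡ v
      update-self x q v with q ≟ q
      ... | yes _  = refl
      ... | no q≢q = contradiction refl q≢q

      update-other : ∀ x {p q} v → p ≢ q → (x [ q ↦ v ]) p ≡ x p
      update-other x {p} {q} v p≢q with p ≟ q
      ... | yes p≡q = contradiction p≡q p≢q
      ... | no  _   = refl

    update-map : ∀ x {q} v {Q} → All (_≢ q) Q → map (x [ q ↦ v ]) Q ≡ map x Q
    update-map x v []            = refl
    update-map x v (p≢q ∷ Q∌q) = cong₂ _∷_ (update-other x v p≢q) (update-map x v Q∌q)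

    -- The law of the value at q given the values at its parents; the root has its
    -- own law, in E.
    K : Pos → State → Fin n → ℚ
    K ([]    , [])    x v = 0ℚ
    K (i ∷ t , [])    x v = k (x (t , [])) v
    K ([]    , j ∷ s) x v = k (x ([] , s)) v
    K (i ∷ t , j ∷ s) x v = κ (x (i ∷ t , s)) (x (t , j ∷ s)) v

    K-nonneg : ∀ q x v → 0ℚ ≤ K q x v
    K-nonneg ([]    , [])    x v = ≤-refl
    K-nonneg (i ∷ t , [])    x v = k-nonneg _ _
    K-nonneg ([]    , j ∷ s) x v = k-nonneg _ _
    K-nonneg (i ∷ t , j ∷ s) x v = κ-nonneg _ _ _

    sum-K≤1 : ∀ q x → sum (K q x) ≤ 1ℚ
    sum-K≤1 ([]    , [])    x = subst (_≤ 1ℚ) (sym (sum-zero {n} λ _ → refl)) 0≤1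
    sum-K≤1 (i ∷ t , [])    x = sum-k≤1 _
    sum-K≤1 ([]    , j ∷ s) x = sum-k≤1 _
    sum-K≤1 (i ∷ t , j ∷ s) x = sum-κ≤1 _ _

    K-average : ∀ q x {z} → 0ℚ ≤ z → sum (λ v → K q x v * z) ≤ z
    K-average q x {z} 0≤z = begin
      sum (λ v → K q x v * z) ≡⟨ *-distribʳ-sum z (K q x) ⟨
      sum (K q x) * z         ≤⟨ *-mono-≤ʳ 0≤z (sum-K≤1 q x) ⟩
      1ℚ * z                  ≡⟨ *-identityˡ z ⟩
      z                       ∎
      where open ≤-Reasoning

    -- The expectation multiplied by the total degree.
    E : ∀ {C} → Ordered C → (State → ℚ) → ℚ
    -- The constant state also fills the positions that are still to be drawn.
    E root                   f = sum λ v → d v * f (λ _ → v)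
    E (extend {q = q} o _ _) f = E o λ x → sum λ v → K q x v * f (x [ q ↦ v ])

    E-mono : ∀ {C} (o : Ordered C) {f g} → (∀ x → f x ≤ g x) → E o f ≤ E o g
    E-mono root f≤g = sum-mono λ v → *-mono-≤ˡ (d-nonneg v) (f≤g _)
    E-mono (extend {q = q} o _ _) f≤g =
      E-mono o λ x → sum-mono λ v → *-mono-≤ˡ (K-nonneg q x v) (f≤g _)

    E-cong : ∀ {C} (o : Ordered C) {f g} → (∀ x → f x ≡ g x) → E o f ≡ E o g
    E-cong o f≡g = ≤-antisym (E-mono o (≤-reflexive ∘ f≡g)) (E-mono o (≤-reflexive ∘ sym ∘ f≡g))

    sum-*-+ : ∀ (c f g : Fin n → ℚ) →
              sum (λ v → c v * (f v + g v)) ≡ sum (λ v → c v * f v) + sum (λ v → c v * g v)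
    sum-*-+ c f g = trans (sum-cong-≗ λ v → *-distribˡ-+ (c v) (f v) (g v))
      (∑-distrib-+ (λ v → c v * f v) (λ v → c v * g v))

    E-+ : ∀ {C} (o : Ordered C) f g → E o (λ x → f x + g x) ≡ E o f + E o g
    E-+ root f g = sum-*-+ d (λ v → f λ _ → v) (λ v → g λ _ → v)
    E-+ (extend {q = q} o _ _) f g = trans
      (E-cong o λ x → sum-*-+ (K q x) (λ v → f (x [ q ↦ v ])) (λ v → g (x [ q ↦ v ])))
      (E-+ o _ _)

    sum-*-scale : ∀ z (c f : Fin n → ℚ) → sum (λ v → c v * (z * f v)) ≡ z * sum (λ v → c v * f v)
    sum-*-scale z c f = trans (sum-cong-≗ λ v → swap (c v) z (f v)) (sym (*-distribˡ-sum z (λ v → c v * f v)))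
      where
      open +-*-Solver
      swap : ∀ p q r → p * (q * r) ≡ q * (p * r)
      swap = solve 3 (λ p q r → p :* (q :* r) := q :* (p :* r)) refl

    E-scale : ∀ {C} (o : Ordered C) z f → E o (λ x → z * f x) ≡ z * E o f
    E-scale root z f = sum-*-scale z d (λ v → f λ _ → v)
    E-scale (extend {q = q} o _ _) z f = trans
      (E-cong o λ x → sum-*-scale z (K q x) (λ v → f (x [ q ↦ v ])))
      (E-scale o z _)

    Nonneg : (List (Fin n) → ℚ) → Set
    Nonneg g = ∀ us → 0ℚ ≤ g us

    -- The conditional average of g over the value at q is dominated by a function
    -- of a staircase avoiding q, with no larger average over random walks.
    record Dominated (C : List Pos) (q : Pos) (t s : Node) (Q : List Pos) : Set where
      constructor dominated
      field
        {Q′}  : List Pos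
        stair : Stair t s Q′
        Q′⊆C  : All (_∈ C) Q′
        fun   : (List (Fin n) → ℚ) → Fin n → List (Fin n) → ℚ
        nonneg : ∀ {g} → Nonneg g → ∀ u us → 0ℚ ≤ fun g u us
        bound : ∀ {g} → Nonneg g → ∀ x →
                sum (λ v → K q x v * g (map (x [ q ↦ v ]) Q)) ≤ fun g (x (t , s)) (map x Q′)
        walk  : ∀ {g} → Nonneg g → ∀ u → R u (length Q′) (fun g u) ≤ R u (length Q) g

    -- A first position other than `q` keeps its value, so the domination applies to the rest of the
    -- staircase, started from there.
    dominated-∷ : ∀ {C q t s t′ s′ Q} → (∀ {Q′} → Stair t′ s′ Q′ → Stair t s ((t′ , s′) ∷ Q′)) →
                  (t′ , s′) ≢ q → (t′ , s′) ∈ C →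
                  Dominated C q t′ s′ Q → Dominated C q t s ((t′ , s′) ∷ Q)
    dominated-∷ {q = q} {t′ = t′} {s′ = s′} {Q = Q} step p≢q p∈C (dominated {Q′} σ Q′⊆C fun nonneg bound walk) =
      dominated (step σ) (p∈C ∷ Q′⊆C) fun′ nonneg′ bound′ walk′
      where
      fun′ : (List (Fin n) → ℚ) → Fin n → List (Fin n) → ℚ
      fun′ g u []       = 0ℚ
      fun′ g u (v ∷ us) = fun (λ r → g (v ∷ r)) v us
      nonneg′ : ∀ {g} → Nonneg g → ∀ u us → 0ℚ ≤ fun′ g u us
      nonneg′ 0≤g u []       = ≤-refl
      nonneg′ {g} 0≤g u (v ∷ us) = nonneg {λ r → g (v ∷ r)} (λ r → 0≤g (v ∷ r)) v us
      bound′ : ∀ {g} → Nonneg g → ∀ x →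
               sum (λ v → K q x v * g (map (x [ q ↦ v ]) ((t′ , s′) ∷ Q))) ≤
               fun (λ r → g (x (t′ , s′) ∷ r)) (x (t′ , s′)) (map x Q′)
      bound′ {g} 0≤g x = ≤-trans
        (≤-reflexive (sum-cong-≗ λ v → cong (λ u → K q x v * g (u ∷ map (x [ q ↦ v ]) Q)) (update-other x {t′ , s′} v p≢q)))
        (bound {λ r → g (x (t′ , s′) ∷ r)} (λ r → 0≤g (x (t′ , s′) ∷ r)) x)
      walk′ : ∀ {g} → Nonneg g → ∀ u →
              R u (suc (length Q′)) (fun′ g u) ≤ R u (suc (length Q)) g
      walk′ {g} 0≤g u = sum-mono λ v → *-mono-≤ˡ (k-nonneg u v) (walk {λ r → g (v ∷ r)} (λ r → 0≤g (v ∷ r)) v)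

    -- Being the latest, `q` has no child in `C`. So the staircase can reach it only by an `up` step
    -- and must then end or turn `down`. At such a turn it is rerouted through the opposite corner
    -- of the same square, which lies in `C`.
    exchange : ∀ {C q t s Q} → Ordered C → q ∉ C → Stair t s Q → (t , s) ∈ C → All (_∈ q ∷ C) Q →
               Dominated C q t s Q
    exchange {q = q} o q∉ done p∈ [] = dominated done [] (λ g _ → g) (λ 0≤g _ → 0≤g)
      (λ 0≤g x → K-average q x (0≤g [])) (λ _ _ → ≤-refl)
    exchange {q = q} o q∉ (down {t = t} {s} σ) p∈ (p′∈ ∷ Q⊆) with (t , s) ≟ q
    ... | yes refl = contradiction (closed o p∈ left) q∉
    ... | no p′≢q  = dominated-∷ down p′≢q p′∈C (exchange o q∉ σ p′∈C Q⊆)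
      where p′∈C = strengthen p′∈ p′≢q
    exchange {q = q} o q∉ (up {j} {t} {s} σ) p∈ (p′∈ ∷ Q⊆) with (t , j ∷ s) ≟ q
    ... | no p′≢q  = dominated-∷ up p′≢q p′∈C (exchange o q∉ σ p′∈C Q⊆)
      where p′∈C = strengthen p′∈ p′≢q
    -- At the end of the staircase, `q` is drawn by `k` from its only parent, which is the position
    -- before it: this is the last step of the walk.
    exchange {q = q} o q∉ (up done) p∈ (p′∈ ∷ []) | yes refl = dominated done []
      (λ g u _ → sum λ v → k u v * g (v ∷ []))
      (λ 0≤g u _ → sum-nonneg λ v → 0≤* (k-nonneg u v) (0≤g _))
      (λ {g} 0≤g x → ≤-reflexive (sum-cong-≗ λ v →
        cong (λ u → K q x v * g (u ∷ [])) (update-self x q v)))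
      (λ _ _ → ≤-refl)
    exchange o q∉ (up (up τ)) p∈ (p′∈ ∷ p″∈ ∷ _) | yes refl =
      contradiction (closed o (strengthen p″∈ λ ()) right) q∉
    -- The detour passes through the common parent of both parents of `q`. `flip` discards the value
    -- there and redraws it by `κ`, which is exactly the law `K q`.
    exchange {q = q} o q∉ (up {j} (down {t = t} {Q = Q} τ)) p∈ (p′∈ ∷ p″∈ ∷ Q⊆) | yes refl = dominated
      (down (up τ)) (closed o p∈ left ∷ strengthen p″∈ p″≢q ∷ All.zipWith (λ (p≢q , p∈) → strengthen p∈ p≢q) (q∉Q , Q⊆))
      (λ g u → flip u g) nonneg bound (λ {g} 0≤g u → R-flip (length Q) u {g} 0≤g)
      where
      p″≢q : (t , _) ≢ q
      p″≢q ()
      q∉Q : All (_≢ q) Q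
      q∉Q = stair-fresh τ refl
      nonneg : ∀ {g} → Nonneg g → ∀ u us → 0ℚ ≤ flip u g us
      nonneg 0≤g u []           = ≤-refl
      nonneg 0≤g u (_ ∷ [])     = ≤-refl
      nonneg 0≤g u (_ ∷ c ∷ r) = sum-nonneg λ v → 0≤* (κ-nonneg u c v) (0≤g _)
      bound : ∀ {g} → Nonneg g → ∀ x →
              sum (λ v → K q x v * g (map (x [ q ↦ v ]) (q ∷ (t , _) ∷ Q))) ≤
              sum (λ v → K q x v * g (v ∷ x (t , _) ∷ map x Q))
      bound {g} 0≤g x = ≤-reflexive (sum-cong-≗ λ v → cong (λ us → K q x v * g us)
        (cong₂ _∷_ (update-self x q v) (update-map x v (p″≢q ∷ q∉Q))))

    -- Induction along the sampling order. If the latest position starts the staircase, then, lying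
    -- in the first row, it is a `k`-step from the second position, and `prepend` applies. Any other
    -- latest position is removed by `exchange`.
    law-from-first-row : ∀ {C t Q} (o : Ordered C) → Stair t [] Q → All (_∈ C) ((t , []) ∷ Q) →
                         ∀ {f} → Nonneg f →
                         E o (λ x → f (map x ((t , []) ∷ Q))) ≤ π (length Q) f
    law-from-first-row root done _ _ = ≤-refl
    law-from-first-row root (down σ) (here () ∷ _)
    law-from-first-row root (up σ) (_ ∷ here () ∷ _)
    law-from-first-row {t = t} (extend {q} o q∉ par) σ (p∈ ∷ Q⊆) 0≤f with (t , []) ≟ q
    law-from-first-row (extend o q∉ par) done _ _ | yes refl = contradiction (root∈ o) q∉
    law-from-first-row (extend o q∉ par) (up σ) (_ ∷ p∈ ∷ _) _ | yes refl =
      contradiction (closed o (strengthen p∈ λ ()) right) q∉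
    law-from-first-row (extend {q} o q∉ par) (down {t = t} {Q = Q} σ) (_ ∷ _ ∷ Q⊆) {f} 0≤f | yes refl = begin
      E o (λ x → sum λ v → K q x v * f (map (x [ q ↦ v ]) (q ∷ P)))
        ≡⟨ E-cong o (λ x → sum-cong-≗ λ v → cong (λ us → K q x v * f us)
             (cong₂ _∷_ (update-self x q v) (update-map x v q∉P))) ⟩
      E o (λ x → prepend f (map x P))
        ≤⟨ law-from-first-row o σ (par left ∷ All.zipWith (λ (p≢q , p∈) → strengthen p∈ p≢q) (q∉Q , Q⊆)) prepend-nonneg ⟩
      π (length Q) (prepend f)
        ≡⟨ π-prepend (length Q) f ⟩
      π (suc (length Q)) f ∎
      where
      open ≤-Reasoning
      P = (t , []) ∷ Q
      q∉Q : All (_≢ q) Q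
      q∉Q = stair-fresh σ refl
      q∉P : All (_≢ q) P
      q∉P = (λ ()) ∷ q∉Q
      prepend-nonneg : ∀ us → 0ℚ ≤ prepend f us
      prepend-nonneg []      = ≤-refl
      prepend-nonneg (b ∷ r) = sum-nonneg λ v → 0≤* (k-nonneg b v) (0≤f _)
    law-from-first-row {t = t} {Q} (extend {q} o q∉ par) σ (p∈ ∷ Q⊆) {f} 0≤f | no p≢q = begin
      E o (λ x → sum λ v → K q x v * f ((x [ q ↦ v ]) (t , []) ∷ map (x [ q ↦ v ]) Q))
        ≡⟨ E-cong o (λ x → sum-cong-≗ λ v → cong (λ u → K q x v * f (u ∷ map (x [ q ↦ v ]) Q)) (update-other x v p≢q)) ⟩
      E o (λ x → sum λ v → K q x v * f (x (t , []) ∷ map (x [ q ↦ v ]) Q))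
        ≤⟨ E-mono o (λ x → bound (λ us → 0≤f (x (t , []) ∷ us)) x) ⟩
      E o (λ x → h (map x ((t , []) ∷ Q′)))
        ≤⟨ law-from-first-row o stair (p∈C ∷ Q′⊆C) h-nonneg ⟩
      π (length Q′) h
        ≤⟨ sum-mono (λ v → *-mono-≤ˡ (d-nonneg v) (walk (λ us → 0≤f (v ∷ us)) v)) ⟩
      π (length Q) f ∎
      where
      open ≤-Reasoning
      p∈C = strengthen p∈ p≢q
      open Dominated (exchange o q∉ σ p∈C Q⊆)
      h : List (Fin n) → ℚ
      h []       = 0ℚ
      h (u ∷ us) = fun (λ r → f (u ∷ r)) u us
      h-nonneg : ∀ us → 0ℚ ≤ h us
      h-nonneg []       = ≤-refl
      h-nonneg (u ∷ us) = nonneg (λ r → 0≤f (u ∷ r)) u us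

    -- The law at an inner starting position depends on both parents, of which the staircase visits
    -- at most one. So the staircase is prolonged backwards to the first row, and the added start is
    -- dropped afterwards.
    law : ∀ {C t s Q} (o : Ordered C) → Stair t s Q → All (_∈ C) ((t , s) ∷ Q) →
          ∀ {f} → Nonneg f → E o (λ x → f (map x ((t , s) ∷ Q))) ≤ π (length Q) f
    law {s = []}            o σ P⊆C             0≤f = law-from-first-row o σ P⊆C 0≤f
    law {s = j ∷ s} {Q = Q} o σ P⊆C@(p∈ ∷ _) {f} 0≤f = ≤-trans
      (law o (up σ) (closed o p∈ right ∷ P⊆C) {afterHead f} afterHead-nonneg)
      (π-afterHead (length Q) 0≤f)
      where
      afterHead-nonneg : ∀ us → 0ℚ ≤ afterHead f us
      afterHead-nonneg []       = ≤-refl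
      afterHead-nonneg (_ ∷ us) = 0≤f us

    collisionsWith : Fin n → List Pos → State → ℚ
    collisionsWith u []      x = 0ℚ
    collisionsWith u (p ∷ C) x = δ u (x p) + collisionsWith u C x

    collisions : List Pos → State → ℚ
    collisions []      x = 0ℚ
    collisions (q ∷ C) x = collisionsWith (x q) C x + collisions C x

    collisionsWith-nonneg : ∀ u C x → 0ℚ ≤ collisionsWith u C x
    collisionsWith-nonneg u []      x = ≤-refl
    collisionsWith-nonneg u (p ∷ C) x = 0≤+ (δ-nonneg u (x p)) (collisionsWith-nonneg u C x)

    collisions-nonneg : ∀ C x → 0ℚ ≤ collisions C x
    collisions-nonneg []      x = ≤-refl
    collisions-nonneg (q ∷ C) x = 0≤+ (collisionsWith-nonneg (x q) C x) (collisions-nonneg C x)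

    collisionsWith-update : ∀ u {q} C x v → q ∉ C → collisionsWith u C (x [ q ↦ v ]) ≡ collisionsWith u C x
    collisionsWith-update u []      x v q∉ = refl
    collisionsWith-update u (p ∷ C) x v q∉ = cong₂ _+_
      (cong (δ u) (update-other x v λ p≡q → q∉ (here (sym p≡q))))
      (collisionsWith-update u C x v (q∉ ∘ there))

    collisions-update : ∀ {q} C x v → q ∉ C → collisions C (x [ q ↦ v ]) ≡ collisions C x
    collisions-update []      x v q∉ = refl
    collisions-update {q} (p ∷ C) x v q∉ = cong₂ _+_
      (trans (collisionsWith-update _ C x v (q∉ ∘ there))
        (cong (λ u → collisionsWith u C x) (update-other x v λ p≡q → q∉ (here (sym p≡q)))))
      (collisions-update C x v (q∉ ∘ there))

    -- Under this invariant the transition laws have total mass 1, as the averaging in `witness`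
    -- requires. The degree condition covers the root position while it has no neighbour in `C` yet.
    Valid : List Pos → State → Set
    Valid C x = (∀ {p} → p ∈ C → d (x p) ≢ 0ℚ) × (∀ {p q} → q ∈ C → p ◁ q → x p ~ x q)

    sum-k≡1 : ∀ u → d u ≢ 0ℚ → sum (k u) ≡ 1ℚ
    sum-k≡1 u du≢0 = trans (sum-k u) (*-inv du≢0)

    w≢0 : ∀ {u b c} → u ~ b → b ~ c → w u c ≢ 0ℚ
    w≢0 {u} {b} {c} u~b b~c w≡0 = inv≢0 (d≢0 b~c) (≤-antisym
      (subst₂ _≤_ (trans (cong₂ _*_ (a-adj u~b) (cong (_* inv (d b)) (a-adj b~c)))
        (trans (*-identityˡ _) (*-identityˡ _))) w≡0
        (term≤sum (λ b → 0≤* (a-nonneg u b) (k-nonneg b c)) b))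
      (inv-nonneg (d-nonneg b)))

    -- At an inner position, the image of `(t , s)` is a common neighbour of the images of both
    -- parents, so the normalising `w` is nonzero.
    sum-K≡1 : ∀ {C q x} → Ordered C → q ∉ C → (∀ {p} → p ◁ q → p ∈ C) → Valid C x → sum (K q x) ≡ 1ℚ
    sum-K≡1 {q = []    , []}    o q∉ par _ = contradiction (root∈ o) q∉
    sum-K≡1 {q = i ∷ t , []}    o q∉ par (d≢0 , _) = sum-k≡1 _ (d≢0 (par left))
    sum-K≡1 {q = []    , j ∷ s} o q∉ par (d≢0 , _) = sum-k≡1 _ (d≢0 (par right))
    sum-K≡1 {q = i ∷ t , j ∷ s} o q∉ par (d≢0 , adj) = trans (sum-κ _ _)
      (*-inv (w≢0 (~-sym (adj (par right) left)) (adj (par left) right)))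

    K-adjacent : ∀ {p q} x v → K q x v ≢ 0ℚ → p ◁ q → x p ~ v
    K-adjacent {q = i ∷ t , []}    x v K≢0 left  = adj-a (*≢0ˡ (a _ _) K≢0)
    K-adjacent {q = []    , j ∷ s} x v K≢0 right = adj-a (*≢0ˡ (a _ _) K≢0)
    K-adjacent {q = i ∷ t , j ∷ s} x v K≢0 left  =
      ~-sym (adj-a (*≢0ˡ (a _ _) (*≢0ʳ (a _ _) (*≢0ˡ (a _ _ * k _ _) K≢0))))
    K-adjacent {q = i ∷ t , j ∷ s} x v K≢0 right =
      adj-a (*≢0ˡ (a _ _) (*≢0ˡ (a _ _ * k _ _) K≢0))

    has-parent : ∀ {C q} → Ordered C → q ∉ C → ∃ λ p → p ◁ q
    has-parent {q = []    , []}    o q∉ = contradiction (root∈ o) q∉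
    has-parent {q = i ∷ t , s}     o q∉ = _ , left
    has-parent {q = []    , j ∷ s} o q∉ = _ , right

    valid-update : ∀ {C q} x v → Ordered C → q ∉ C → (∀ {p} → p ◁ q → p ∈ C) → Valid C x →
                   K q x v ≢ 0ℚ → Valid (q ∷ C) (x [ q ↦ v ])
    valid-update {C} {q} x v o q∉ par (deg , adj) K≢0 = deg′ , adj′
      where
      old : ∀ {p} → p ∈ C → (x [ q ↦ v ]) p ≡ x p
      old p∈ = update-other x v λ { refl → q∉ p∈ }
      deg′ : ∀ {p} → p ∈ q ∷ C → d ((x [ q ↦ v ]) p) ≢ 0ℚ
      deg′ (here refl) = subst (λ u → d u ≢ 0ℚ) (sym (update-self x q v))
        (d≢0 (~-sym (K-adjacent x v K≢0 (proj₂ (has-parent o q∉)))))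
      deg′ (there p∈) = subst (λ u → d u ≢ 0ℚ) (sym (old p∈)) (deg p∈)
      adj′ : ∀ {p r} → r ∈ q ∷ C → p ◁ r → (x [ q ↦ v ]) p ~ (x [ q ↦ v ]) r
      adj′ (here refl) p◁q = subst₂ _~_ (sym (old (par p◁q))) (sym (update-self x q v)) (K-adjacent x v K≢0 p◁q)
      adj′ (there r∈) p◁r  = subst₂ _~_ (sym (old (closed o r∈ p◁r))) (sym (old r∈)) (adj r∈ p◁r)

    -- The method of conditional expectations: positions are fixed in sampling order, each at a
    -- value of nonzero weight, with the conditional average of `f` kept below 1.
    witness : ∀ {C} (o : Ordered C) f → E o f < sum d → ∃ λ x → Valid C x × f x < 1ℚ
    witness root f Ef<d with sum-witness d (λ v → f λ _ → v) d-nonneg Ef<d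
    ... | v , dv≢0 , fv<1 = (λ _ → v) , ((λ { (here refl) → dv≢0 ; (there ()) }) , (λ { (here refl) () })) , fv<1
    witness (extend {q} o q∉ par) f Ef<d with witness o _ Ef<d
    ... | x , valid , avg<1 with sum-witness (K q x) (λ v → f (x [ q ↦ v ])) (K-nonneg q x)
                                   (subst (sum (λ v → K q x v * f (x [ q ↦ v ])) <_) (sym (sum-K≡1 o q∉ par valid)) avg<1)
    ...   | v , K≢0 , f<1 = x [ q ↦ v ] , valid-update x v o q∉ par valid K≢0 , f<1

    noCollisionWith : ∀ {C x u} → collisionsWith u C x < 1ℚ → ∀ {p} → p ∈ C → u ≢ x p
    noCollisionWith {C = q ∷ C} {x} c<1 (here refl) refl = <-irrefl refl
      (<-≤-trans c<1 (≤-trans (≤-reflexive (sym (δ-refl (x q)))) (p≤p+q (collisionsWith-nonneg (x q) C x))))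
    noCollisionWith {C = q ∷ C} {x} {u} c<1 (there p∈) =
      noCollisionWith (≤-<-trans (q≤p+q (δ-nonneg u (x q))) c<1) p∈

    injective : ∀ {C x} → collisions C x < 1ℚ → ∀ {p q} → p ∈ C → q ∈ C → x p ≡ x q → p ≡ q
    injective {r ∷ C} {x} c<1 = λ
      { (here refl) (here refl) _  → refl
      ; (here refl) (there q∈)  eq → contradiction eq (noCollisionWith head<1 q∈)
      ; (there p∈)  (here refl) eq → contradiction (sym eq) (noCollisionWith head<1 p∈)
      ; (there p∈)  (there q∈)  eq → injective tail<1 p∈ q∈ eq }
      where
      head<1 : collisionsWith (x r) C x < 1ℚ
      head<1 = ≤-<-trans (p≤p+q (collisions-nonneg C x)) c<1
      tail<1 : collisions C x < 1ℚ
      tail<1 = ≤-<-trans (q≤p+q (collisionsWith-nonneg (x r) C x)) c<1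

    ∑1 ∑∑1 : ℚ
    ∑1  = sum {n} λ _ → 1ℚ
    ∑∑1 = sum {n} λ _ → ∑1

    E-inv-d : ∀ {C p} (o : Ordered C) → p ∈ C → E o (λ x → inv (d (x p))) ≤ ∑1
    E-inv-d {p = t , s} o p∈ with stair-column o t s p∈
    ... | Q , σ , Q⊆C = ≤-trans (law o σ (p∈ ∷ Q⊆C) inv-d-head-nonneg) (π-inv-d (length Q))

    E-inv-w : ∀ {C i t j s} (o : Ordered C) → (i ∷ t , s) ∈ C → (t , j ∷ s) ∈ C →
              E o (λ x → inv (w (x (i ∷ t , s)) (x (t , j ∷ s)))) ≤ ∑∑1
    E-inv-w {t = t} {j} {s} o p∈ p′∈ with stair-column o t (j ∷ s) p′∈
    ... | Q , σ , Q⊆C = ≤-trans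
      (law o (down (up σ)) (p∈ ∷ closed o p∈ left ∷ p′∈ ∷ Q⊆C) inv-w-cherry-nonneg)
      (π-inv-w (length Q))

    ∑1-nonneg : 0ℚ ≤ ∑1
    ∑1-nonneg = sum-nonneg {n} λ _ → 0≤1

    module _ {ℓ μ : ℚ} (1≤ℓ : 1ℚ ≤ ℓ) (0≤μ : 0ℚ ≤ μ) (ℓμ≡1 : ℓ * μ ≡ 1ℚ) where

      0≤ℓ : 0ℚ ≤ ℓ
      0≤ℓ = ≤-trans 0≤1 1≤ℓ

      -- Bounds D times the probability that a new position collides with a given old one. It equals
      -- `ℓ` n + n² / `ℓ`, which is smallest for `ℓ` near the square root of n.
      ε : ℚ
      ε = ℓ * ∑1 + μ * ∑∑1

      ε-nonneg : 0ℚ ≤ ε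
      ε-nonneg = 0≤+ (0≤* 0≤ℓ ∑1-nonneg) (0≤* 0≤μ (sum-nonneg {n} λ _ → ∑1-nonneg))

      k≤ : ∀ u v → k u v ≤ ℓ * inv (d u)
      k≤ u v = *-mono-≤ʳ (inv-nonneg (d-nonneg u)) (≤-trans (a≤1 u v) 1≤ℓ)

      -- κ ≤ min (1 , yz) ≤ ℓ y + μ z, where y = inv (d v) and z = inv (w u c).
      κ≤ : ∀ u c v → κ u c v ≤ ℓ * inv (d v) + μ * inv (w u c)
      -- If z is at most `ℓ`, then y z is at most `ℓ` y; otherwise 1 = `μ` `ℓ` is at most `μ` z.
      κ≤ u c v with ≤-total (inv (w u c)) ℓ
      ... | inj₁ iw≤ℓ = begin
        a u v * k v c * inv (w u c) ≤⟨ *-mono-≤ʳ (inv-nonneg (w-nonneg u c)) a*k≤ ⟩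
        inv (d v) * inv (w u c)     ≤⟨ *-mono-≤ˡ (inv-nonneg (d-nonneg v)) iw≤ℓ ⟩
        inv (d v) * ℓ               ≡⟨ *-comm (inv (d v)) ℓ ⟩
        ℓ * inv (d v)               ≤⟨ p≤p+q (0≤* 0≤μ (inv-nonneg (w-nonneg u c))) ⟩
        ℓ * inv (d v) + μ * inv (w u c) ∎
        where
        open ≤-Reasoning
        a*k≤ : a u v * k v c ≤ inv (d v)
        a*k≤ = begin
          a u v * k v c      ≤⟨ *-mono-≤ʳ (k-nonneg v c) (a≤1 u v) ⟩
          1ℚ * k v c         ≡⟨ *-identityˡ _ ⟩
          a v c * inv (d v)  ≤⟨ *-mono-≤ʳ (inv-nonneg (d-nonneg v)) (a≤1 v c) ⟩
          1ℚ * inv (d v)     ≡⟨ *-identityˡ _ ⟩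
          inv (d v)          ∎
      ... | inj₂ ℓ≤iw = begin
        κ u c v              ≤⟨ term≤sum (κ-nonneg u c) v ⟩
        sum (κ u c)          ≤⟨ sum-κ≤1 u c ⟩
        1ℚ                   ≡⟨ trans (sym ℓμ≡1) (*-comm ℓ μ) ⟩
        μ * ℓ                ≤⟨ *-mono-≤ˡ 0≤μ ℓ≤iw ⟩
        μ * inv (w u c)      ≤⟨ q≤p+q (0≤* 0≤ℓ (inv-nonneg (d-nonneg v))) ⟩
        ℓ * inv (d v) + μ * inv (w u c) ∎
        where open ≤-Reasoning

      E-inv-d≤ε : ∀ {C p} (o : Ordered C) → p ∈ C → E o (λ x → ℓ * inv (d (x p))) ≤ ε
      E-inv-d≤ε {p = p} o p∈ = begin
        E o (λ x → ℓ * inv (d (x p))) ≡⟨ E-scale o ℓ _ ⟩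
        ℓ * E o (λ x → inv (d (x p))) ≤⟨ *-mono-≤ˡ 0≤ℓ (E-inv-d o p∈) ⟩
        ℓ * ∑1                        ≤⟨ p≤p+q (0≤* 0≤μ (sum-nonneg {n} λ _ → ∑1-nonneg)) ⟩
        ε ∎
        where open ≤-Reasoning

      E-K≤ε : ∀ {C p q} (o : Ordered C) → q ∉ C → (∀ {p} → p ◁ q → p ∈ C) → p ∈ C →
              E o (λ x → K q x (x p)) ≤ ε
      E-K≤ε {q = []    , []}    o q∉ par p∈ = contradiction (root∈ o) q∉
      E-K≤ε {q = i ∷ t , []}    o q∉ par p∈ = ≤-trans (E-mono o λ x → k≤ _ _) (E-inv-d≤ε o (par left))
      E-K≤ε {q = []    , j ∷ s} o q∉ par p∈ = ≤-trans (E-mono o λ x → k≤ _ _) (E-inv-d≤ε o (par right))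
      E-K≤ε {p = p} {i ∷ t , j ∷ s} o q∉ par p∈ = begin
        E o (λ x → κ (x (i ∷ t , s)) (x (t , j ∷ s)) (x p))
          ≤⟨ E-mono o (λ x → κ≤ _ _ _) ⟩
        E o (λ x → ℓ * inv (d (x p)) + μ * inv (w (x (i ∷ t , s)) (x (t , j ∷ s))))
          ≡⟨ E-+ o _ _ ⟩
        E o (λ x → ℓ * inv (d (x p))) + E o (λ x → μ * inv (w (x (i ∷ t , s)) (x (t , j ∷ s))))
          ≡⟨ cong₂ _+_ (E-scale o ℓ _) (E-scale o μ _) ⟩
        ℓ * E o (λ x → inv (d (x p))) + μ * E o (λ x → inv (w (x (i ∷ t , s)) (x (t , j ∷ s))))
          ≤⟨ +-mono-≤ (*-mono-≤ˡ 0≤ℓ (E-inv-d o p∈)) (*-mono-≤ˡ 0≤μ (E-inv-w o (par right) (par left))) ⟩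
        ε ∎
        where open ≤-Reasoning

      E-collisionsWith : ∀ {C q} (o : Ordered C) → q ∉ C → (∀ {p} → p ◁ q → p ∈ C) →
                         ∀ D → All (_∈ C) D →
                         E o (λ x → sum λ v → K q x v * collisionsWith v D x) ≤ ι (length D) * ε
      E-collisionsWith {q = q} o q∉ par [] [] = begin
        E o (λ x → sum λ v → K q x v * 0ℚ) ≡⟨ E-cong o (λ x → sum-*-scale 0ℚ (K q x) (λ _ → 0ℚ)) ⟩
        E o (λ x → 0ℚ * avg x)             ≡⟨ E-scale o 0ℚ avg ⟩
        0ℚ * E o avg                       ≡⟨ trans (*-zeroˡ (E o avg)) (trans (sym (*-zeroˡ ε)) (cong (_* ε) (sym ι-0))) ⟩
        ι 0 * ε ∎
        where
        open ≤-Reasoning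
        avg : State → ℚ
        avg x = sum λ v → K q x v * 0ℚ
      E-collisionsWith {q = q} o q∉ par (p ∷ D) (p∈ ∷ D⊆C) = begin
        E o (λ x → sum λ v → K q x v * (δ v (x p) + collisionsWith v D x))
          ≡⟨ E-cong o (λ x → trans (sum-*-+ (K q x) (λ v → δ v (x p)) (λ v → collisionsWith v D x))
               (cong (_+ _) (sum-δ (K q x) (x p)))) ⟩
        E o (λ x → K q x (x p) + sum λ v → K q x v * collisionsWith v D x)
          ≡⟨ E-+ o _ _ ⟩
        E o (λ x → K q x (x p)) + E o (λ x → sum λ v → K q x v * collisionsWith v D x)
          ≤⟨ +-mono-≤ (E-K≤ε o q∉ par p∈) (E-collisionsWith o q∉ par D D⊆C) ⟩
        ε + m * ε
          ≡⟨ trans (cong (_+ m * ε) (sym (*-identityˡ ε))) (sym (*-distribʳ-+ ε 1ℚ m)) ⟩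
        (1ℚ + m) * ε
          ≡⟨ cong (_* ε) (ι-suc (length D)) ⟨
        ι (suc (length D)) * ε ∎
        where
        open ≤-Reasoning
        m = ι (length D)

      -- A position drawn after m others adds at most m `ε`, and m + m² is at most (1 + m)².
      E-collisions : ∀ {C} (o : Ordered C) → E o (collisions C) ≤ ι (length C) * ι (length C) * ε
      E-collisions root = begin
        sum (λ v → d v * (0ℚ + 0ℚ)) ≡⟨ sum-zero (λ v → *-zeroʳ (d v)) ⟩
        0ℚ                          ≤⟨ 0≤* (0≤* (ι-nonneg 1) (ι-nonneg 1)) ε-nonneg ⟩
        ι 1 * ι 1 * ε ∎
        where open ≤-Reasoning
      E-collisions (extend {q} {C} o q∉ par) = begin
        E o (λ x → sum λ v → K q x v * collisions (q ∷ C) (x [ q ↦ v ]))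
          ≡⟨ E-cong o (λ x → trans (sum-cong-≗ λ v → cong (K q x v *_) (step x v))
               (sum-*-+ (K q x) (λ v → collisionsWith v C x) (λ _ → collisions C x))) ⟩
        E o (λ x → sum (λ v → K q x v * collisionsWith v C x) + sum (λ v → K q x v * collisions C x))
          ≡⟨ E-+ o _ _ ⟩
        E o (λ x → sum (λ v → K q x v * collisionsWith v C x)) + E o (λ x → sum (λ v → K q x v * collisions C x))
          ≤⟨ +-mono-≤ (E-collisionsWith o q∉ par C (All.tabulate λ p∈ → p∈))
               (≤-trans (E-mono o λ x → K-average q x (collisions-nonneg C x)) (E-collisions o)) ⟩
        m * ε + m * m * ε
          ≤⟨ q≤p+q (0≤+ ε-nonneg (0≤* (ι-nonneg (length C)) ε-nonneg)) ⟩
        (ε + m * ε) + (m * ε + m * m * ε)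
          ≡⟨ square m ε ⟩
        (1ℚ + m) * (1ℚ + m) * ε
          ≡⟨ cong (λ z → z * z * ε) (ι-suc (length C)) ⟨
        ι (suc (length C)) * ι (suc (length C)) * ε ∎
        where
        open ≤-Reasoning
        open +-*-Solver
        m = ι (length C)
        step : ∀ x v → collisions (q ∷ C) (x [ q ↦ v ]) ≡ collisionsWith v C x + collisions C x
        step x v = cong₂ _+_
          (trans (collisionsWith-update _ C x v q∉) (cong (λ u → collisionsWith u C x) (update-self x q v)))
          (collisions-update C x v q∉)
        square : ∀ m e → (e + m * e) + (m * e + m * m * e) ≡ (1ℚ + m) * (1ℚ + m) * e
        square = solve 2 (λ m e → (e :+ m :* e) :+ (m :* e :+ m :* m :* e) :=
          (con 1ℚ :+ m) :* (con 1ℚ :+ m) :* e) refl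

      embedding : ∀ {C} → Ordered C → ι (length C) * ι (length C) * ε < sum d →
                  ∃ λ x → (∀ {p q} → q ∈ C → p ◁ q → x p ~ x q) ×
                          (∀ {p q} → p ∈ C → q ∈ C → x p ≡ x q → p ≡ q)
      embedding o small with witness o _ (≤-<-trans (E-collisions o) small)
      ... | x , (_ , adj) , c<1 = x , adj , injective c<1

-- Rooting a tree and ordering the product.

module TreeLabelling where
  open RandomGrid using (Node; Pos; Ordered; root; extend; _◁_; left; right)
  open import Data.Fin using (inject₁; fromℕ; opposite)
  open import Data.List using (lookup; cartesianProductWith)
  open import Data.List.Properties using (++-identityʳ)
  open import Relation.Binary.Construct.Closure.ReflexiveTransitive using (Star; ε; _◅_)

  -- The nodes of a rooted tree, listed so that every node is preceded (to its
  -- right) by its parent.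
  data Closed : List Node → Set where
    root   : Closed ([] ∷ [])
    extend : ∀ {i t ns} → Closed ns → t ∈ ns → i ∷ t ∉ ns → Closed ((i ∷ t) ∷ ns)

  record Labelling (T : Graph) : Set where
    open Graph T
    field
      nodes      : List Node
      isClosed   : Closed nodes
      node       : V → Node
      node∈      : ∀ v → node v ∈ nodes
      injective  : Injective _≡_ _≡_ node
      parent     : ∀ {u v} → Adj u v → (∃ λ i → node u ≡ i ∷ node v) ⊎ (∃ λ i → node v ≡ i ∷ node u)

  opposite-inject₁ : ∀ {n} (i : Fin n) → opposite (inject₁ i) ≡ suc (opposite i)
  opposite-inject₁ zero    = refl
  opposite-inject₁ (suc i) = cong inject₁ (opposite-inject₁ i)

  opposite-fromℕ : ∀ n → opposite (fromℕ n) ≡ zero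
  opposite-fromℕ zero    = refl
  opposite-fromℕ (suc n) = cong inject₁ (opposite-fromℕ n)

  module _ (T : Graph) where
    open Graph T

    -- Paths are functions on `Fin`, as in `Cycle`, so that a path closed up by one more vertex is
    -- directly a cycle.
    record Path (vs : List V) (u w : V) : Set where
      field
        len      : ℕ
        f        : Fin (suc len) → V
        distinct : Injective _≡_ _≡_ f
        step     : ∀ i → Adj (f (inject₁ i)) (f (suc i))
        start    : f zero ≡ u
        end      : f (fromℕ len) ≡ w
        inside   : ∀ i → f i ∈ vs

    trivial : ∀ {vs v} → v ∈ vs → Path vs v v
    trivial {v = v} v∈ = record
      { len = 0 ; f = λ _ → v ; distinct = λ { {zero} {zero} _ → refl } ; step = λ ()
      ; start = refl ; end = refl ; inside = λ _ → v∈ }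

    weaken : ∀ {vs u w v} → Path vs u w → Path (v ∷ vs) u w
    weaken π = record { Path π ; inside = there ∘ Path.inside π }

    reverse : ∀ {vs u w} → Path vs u w → Path vs w u
    reverse π = record
      { len      = len
      ; f        = f ∘ opposite
      ; distinct = λ {i} {j} eq → trans (sym (Fin.opposite-involutive i))
                     (trans (cong opposite (distinct eq)) (Fin.opposite-involutive j))
      ; step     = λ i → subst (λ j → Adj (f j) (f (inject₁ (opposite i)))) (sym (opposite-inject₁ i))
                     (symmetric (step (opposite i)))
      ; start    = end
      ; end      = trans (cong f (opposite-fromℕ len)) start
      ; inside   = inside ∘ opposite
      }
      where open Path π

    _∷ᶠ_ : ∀ {n} → V → (Fin n → V) → Fin (suc n) → V
    (v ∷ᶠ f) zero    = v
    (v ∷ᶠ f) (suc i) = f i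

    ∷ᶠ-injective : ∀ {n v} {f : Fin n → V} → Injective _≡_ _≡_ f → (∀ i → v ≢ f i) → Injective _≡_ _≡_ (v ∷ᶠ f)
    ∷ᶠ-injective inj v∉ {zero}  {zero}  _  = refl
    ∷ᶠ-injective inj v∉ {zero}  {suc j} eq = contradiction eq (v∉ j)
    ∷ᶠ-injective inj v∉ {suc i} {zero}  eq = contradiction (sym eq) (v∉ i)
    ∷ᶠ-injective inj v∉ {suc i} {suc j} eq = cong suc (inj eq)

    cons : ∀ {vs v u w} → v ∉ vs → Adj v u → Path vs u w → Path (v ∷ vs) v w
    cons {v = v} v∉ v~u π = record
      { len      = suc len
      ; f        = v ∷ᶠ f
      ; distinct = ∷ᶠ-injective distinct λ i v≡fi → v∉ (subst (_∈ _) (sym v≡fi) (inside i))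
      ; step     = λ { zero → subst (Adj v) (sym start) v~u ; (suc i) → step i }
      ; start    = refl
      ; end      = end
      ; inside   = λ { zero → here refl ; (suc i) → there (inside i) }
      }
      where open Path π

    closeUp : ∀ {vs v u w} → v ∉ vs → Adj v u → Adj v w → u ≢ w → Path vs u w → Cycle T
    closeUp v∉ v~u v~w u≢w record { len = zero ; start = start ; end = end } =
      contradiction (trans (sym start) end) u≢w
    -- A path with `suc k` edges has k + 2 vertices; the new vertex makes the k + 3 of the cycle.
    closeUp {v = v} v∉ v~u v~w u≢w π@record { len = suc k ; f = f ; step = step ; end = end } = record
      { k        = k
      ; f        = v ∷ᶠ f
      ; distinct = Path.distinct (cons v∉ v~u π)
      ; step     = Path.step (cons v∉ v~u π)
      ; close    = symmetric (subst (Adj v) (sym end) v~w)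
      }

    -- A subtree, as the list of its vertices paired with their nodes.
    data Grown : List (V × Node) → Set where
      root : ∀ r → Grown ((r , []) ∷ [])
      grow : ∀ {L u t v} → Grown L → v ∉ map proj₁ L → (u , t) ∈ L → Adj u v →
             Grown ((v , toℕ (index v) ∷ t) ∷ L)

    connect : ∀ {L} → Grown L → ∀ {u w} → u ∈ map proj₁ L → w ∈ map proj₁ L → Path (map proj₁ L) u w
    connect (root r) (here refl) (here refl) = trivial (here refl)
    connect (grow g v∉ p∈ p~v) (here refl) (here refl) = trivial (here refl)
    connect (grow g v∉ p∈ p~v) (here refl) (there w∈) =
      cons v∉ (symmetric p~v) (connect g (∈-map⁺ proj₁ p∈) w∈)
    connect (grow g v∉ p∈ p~v) (there u∈) (here refl) =
      reverse (cons v∉ (symmetric p~v) (connect g (∈-map⁺ proj₁ p∈) u∈))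
    connect (grow g v∉ p∈ p~v) (there u∈) (there w∈) = weaken (connect g u∈ w∈)

    -- Labels are indices of vertices, so a node other than the root determines its vertex, and new
    -- vertices get new nodes.
    label : ∀ {L v i t} → Grown L → (v , i ∷ t) ∈ L → i ≡ toℕ (index v)
    label (root r)       (here ())
    label (grow g _ _ _) (here refl) = refl
    label (grow g _ _ _) (there v∈)  = label g v∈

    label-fresh : ∀ {L v t} → Grown L → v ∉ map proj₁ L → toℕ (index v) ∷ t ∉ map proj₂ L
    label-fresh {L} g v∉ n∈ with ∈-map⁻ proj₂ n∈
    ... | (u , _) , u∈ , refl = v∉ (subst (_∈ map proj₁ L)
      (sym (index-injective (Fin.toℕ-injective (label g u∈)))) (∈-map⁺ proj₁ u∈))

    node-unique : ∀ {L v t t′} → Grown L → (v , t) ∈ L → (v , t′) ∈ L → t ≡ t′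
    node-unique (root r)        (here refl) (here refl) = refl
    node-unique (grow g v∉ _ _) (here refl) (here refl) = refl
    node-unique (grow g v∉ _ _) (here refl) (there v∈)  = contradiction (∈-map⁺ proj₁ v∈) v∉
    node-unique (grow g v∉ _ _) (there v∈)  (here refl) = contradiction (∈-map⁺ proj₁ v∈) v∉
    node-unique (grow g v∉ _ _) (there v∈)  (there v∈′) = node-unique g v∈ v∈′

    vertex-unique : ∀ {L u v t} → Grown L → (u , t) ∈ L → (v , t) ∈ L → u ≡ v
    vertex-unique (root r)        (here refl) (here refl) = refl
    vertex-unique (grow g v∉ _ _) (here refl) (here refl) = refl
    vertex-unique (grow g v∉ _ _) (here refl) (there v∈)  = contradiction (∈-map⁺ proj₂ v∈) (label-fresh g v∉)
    vertex-unique (grow g v∉ _ _) (there u∈)  (here refl) = contradiction (∈-map⁺ proj₂ u∈) (label-fresh g v∉)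
    vertex-unique (grow g v∉ _ _) (there u∈)  (there v∈)  = vertex-unique g u∈ v∈

    nodes-closed : ∀ {L} → Grown L → Closed (map proj₂ L)
    nodes-closed (root r)         = root
    nodes-closed (grow g v∉ p∈ _) = extend (nodes-closed g) (∈-map⁺ proj₂ p∈) (label-fresh g v∉)

    -- A second neighbour of the new vertex would close a cycle.
    only-parent : ∀ {L u t v w t′} → ¬ Cycle T → Grown L → v ∉ map proj₁ L → (u , t) ∈ L → Adj u v →
                  (w , t′) ∈ L → Adj v w → t ≡ t′
    only-parent {u = u} {w = w} acyclic g v∉ u∈ u~v w∈ v~w with u ≟ w
    ... | yes refl = node-unique g u∈ w∈
    ... | no u≢w   = contradiction (closeUp v∉ (symmetric u~v) v~w u≢w
                       (connect g (∈-map⁺ proj₁ u∈) (∈-map⁺ proj₁ w∈))) acyclic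

    related : ∀ {L u v t t′} → ¬ Cycle T → Grown L → (u , t) ∈ L → (v , t′) ∈ L → Adj u v →
              (∃ λ i → t ≡ i ∷ t′) ⊎ (∃ λ i → t′ ≡ i ∷ t)
    related acyclic (root r)            (here refl) (here refl) u~v = contradiction u~v (irreflexive refl)
    related acyclic (grow g v∉ p∈ p~v) (here refl) (here refl) u~v = contradiction u~v (irreflexive refl)
    related acyclic (grow g v∉ p∈ p~v) (here refl) (there w∈) u~v =
      inj₁ (_ , cong (_ ∷_) (only-parent acyclic g v∉ p∈ p~v w∈ u~v))
    related acyclic (grow g v∉ p∈ p~v) (there u∈) (here refl) u~v =
      inj₂ (_ , cong (_ ∷_) (only-parent acyclic g v∉ p∈ p~v u∈ (symmetric u~v)))
    related acyclic (grow g v∉ p∈ p~v) (there u∈) (there w∈) u~v = related acyclic g u∈ w∈ u~v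

    lookup-injective : ∀ {L} → Grown L → Injective _≡_ _≡_ (proj₁ ∘ lookup L)
    lookup-injective (root r)       {zero} {zero} _ = refl
    lookup-injective (grow _ _ _ _) {zero} {zero} _ = refl
    lookup-injective (grow {L} g v∉ _ _) {zero} {suc j} eq =
      contradiction (subst (_∈ map proj₁ L) (sym eq) (∈-map⁺ proj₁ (∈-lookup j))) v∉
    lookup-injective (grow {L} g v∉ _ _) {suc i} {zero} eq =
      contradiction (subst (_∈ map proj₁ L) eq (∈-map⁺ proj₁ (∈-lookup i))) v∉
    lookup-injective (grow g _ _ _) {suc i} {suc j} eq = cong suc (lookup-injective g eq)

    length≤order : ∀ {L} → Grown L → length L ℕ.≤ order
    length≤order g = Fin.injective⇒≤ (lookup-injective g ∘ index-injective)

    open DecMembership _≟_ using (_∈?_)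

    crossing : ∀ {vs u w} → Star Adj u w → u ∈ vs → w ∉ vs → ∃₂ λ x y → x ∈ vs × y ∉ vs × Adj x y
    crossing ε u∈ w∉ = contradiction u∈ w∉
    crossing {vs} {u} (_◅_ {j = v} u~v v⋆w) u∈ w∉ with v ∈? vs
    ... | yes v∈ = crossing v⋆w v∈ w∉
    ... | no  v∉ = u , v , u∈ , v∉ , u~v

    head∈ : ∀ {L} → Grown L → ∃ λ v → v ∈ map proj₁ L
    head∈ (root r)       = r , here refl
    head∈ (grow _ _ _ _) = _ , here refl

    Spanning : List (V × Node) → Set
    Spanning L = ∀ v → v ∈ map proj₁ L

    grow-step : Connected T → ∀ {L} → Grown L →
                Spanning L ⊎ (∃ λ L′ → Grown L′ × length L′ ≡ suc (length L))
    grow-step (_ , connected) {L} g with Fin.all? (λ i → vertex i ∈? map proj₁ L)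
    ... | yes all∈ = inj₁ λ v → subst (_∈ map proj₁ L) (vertex-index v) (all∈ (index v))
    ... | no ¬all∈ with Fin.¬∀⟶∃¬ order _ (λ i → vertex i ∈? map proj₁ L) ¬all∈
    ...   | i , i∉ with crossing (connected _ (vertex i)) (proj₂ (head∈ g)) i∉
    ...     | x , y , x∈ , y∉ , x~y with ∈-map⁻ proj₁ x∈
    ...       | (_ , t) , xt∈ , refl = inj₂ (_ , grow g y∉ xt∈ x~y , refl)

    -- The counter ensures termination: no subtree has `suc order` vertices, so for m = `order` the
    -- first alternative must hold.
    grow-to : Connected T → ∀ m → (∃ λ L → Grown L × Spanning L) ⊎ (∃ λ L → Grown L × length L ≡ suc m)
    grow-to conn@(r , _) zero = inj₂ (_ , root r , refl)
    grow-to conn (suc m) with grow-to conn m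
    ... | inj₁ spanned = inj₁ spanned
    ... | inj₂ (L , g , len) with grow-step conn g
    ...   | inj₁ spanning         = inj₁ (L , g , spanning)
    ...   | inj₂ (L′ , g′ , len′) = inj₂ (L′ , g′ , trans len′ (cong suc len))

    span : Connected T → ∃ λ L → Grown L × Spanning L
    span conn with grow-to conn order
    ... | inj₁ spanned       = spanned
    ... | inj₂ (L , g , len) = contradiction (subst (ℕ._≤ order) len (length≤order g)) (ℕ.<⇒≱ ℕ.≤-refl)

    labelling : IsTree T → Labelling T
    labelling (conn , acyclic) with span conn
    ... | L , g , spanning = record
      { nodes     = map proj₂ L
      ; isClosed  = nodes-closed g
      ; node      = node
      ; node∈     = λ v → ∈-map⁺ proj₂ (entry v)
      ; injective = λ {u} {v} eq → vertex-unique g (entry u) (subst (λ t → (v , t) ∈ L) (sym eq) (entry v))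
      ; parent    = λ {u} {v} → related acyclic g (entry u) (entry v)
      }
      where
      found : ∀ v → ∃ λ t → (v , t) ∈ L
      found v with ∈-map⁻ proj₁ (spanning v)
      ... | (_ , t) , vt∈ , refl = t , vt∈
      node : V → Node
      node v = proj₁ (found v)
      entry : ∀ v → (v , node v) ∈ L
      entry v = proj₂ (found v)

  -- The flipped arguments make `cartesianProductWith` list the grid by rows, one for each node of
  -- the second tree.
  pos : Node → Node → Pos
  pos s t = t , s

  grid : List Node → List Node → List Pos
  grid ns ms = cartesianProductWith pos ms ns

  first-row : ∀ {ns} → Closed ns → Ordered (map (pos []) ns)
  first-row root = root
  first-row (extend c t∈ t∉) = extend (first-row c) fresh λ { left → ∈-map⁺ (pos []) t∈ }
    where
    fresh : _ ∉ _
    fresh q∈ with ∈-map⁻ (pos []) q∈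
    ... | _ , u∈ , refl = t∉ u∈

  next-row : ∀ {ns j s C} → Closed ns → Ordered C → (∀ {t} → (t , j ∷ s) ∉ C) → (∀ {t} → t ∈ ns → (t , s) ∈ C) →
             Ordered (map (pos (j ∷ s)) ns ++ C)
  next-row root o fresh below = extend o fresh λ { right → below (here refl) }
  next-row {(i ∷ t) ∷ ns} {j} {s} {C} (extend c t∈ t∉) o fresh below = extend (next-row c o fresh (below ∘ there)) new
    λ { left  → ∈-++⁺ˡ (∈-map⁺ (pos (j ∷ s)) t∈)
      ; right → ∈-++⁺ʳ (map (pos (j ∷ s)) ns) (below (here refl)) }
    where
    new : (i ∷ t , j ∷ s) ∉ map (pos (j ∷ s)) ns ++ C
    new q∈ with ∈-++⁻ (map (pos (j ∷ s)) ns) q∈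
    ... | inj₂ q∈C = fresh q∈C
    ... | inj₁ q∈row with ∈-map⁻ (pos (j ∷ s)) q∈row
    ...   | _ , u∈ , refl = t∉ u∈

  grid-ordered : ∀ {ns ms} → Closed ns → Closed ms → Ordered (grid ns ms)
  grid-ordered {ns} c root = subst Ordered (sym (++-identityʳ (map (pos []) ns))) (first-row c)
  grid-ordered {ns} c (extend {ns = ms} c′ s∈ s∉) = next-row c (grid-ordered c c′)
    (λ q∈ → s∉ (grid-⊆ q∈)) (λ t∈ → ∈-cartesianProductWith⁺ pos s∈ t∈)
    where
    grid-⊆ : ∀ {t s} → (t , s) ∈ grid ns ms → s ∈ ms
    grid-⊆ q∈ with ∈-cartesianProductWith⁻ pos ms ns q∈
    ... | _ , _ , s∈ , _ , refl = s∈

-- A prime between x and 16x.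

module PrimeGaps where
  open import Data.List.Relation.Unary.All.Properties using (¬Any⇒All¬)
  open import Data.List.Relation.Unary.Any using (any?)
  open import Data.Nat
  open import Data.Nat.Combinatorics using (_C_; nCk+nC[k+1]≡[n+1]C[k+1]; nCk≡n!/k![n-k]!; k![n∸k]!∣n!)
  open import Data.Nat.DivMod using (m/n*n≡m)
  open import Data.Nat.Divisibility
  open import Data.Nat.ListAction using (product)
  open import Data.Nat.ListAction.Properties using (∈⇒∣product)
  open import Data.Nat.Primality using (prime?; euclidsLemma; prime⇒nonZero; prime⇒nonTrivial)
  open import Data.Nat.Primality.Factorisation using (PrimeFactorisation; factorise)
  open import Data.Nat.Properties
  open import Data.Nat.Solver using (module +-*-Solver)
  open import Relation.Nullary.Decidable using (_×-dec_; toWitness)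

  C-pascal : ∀ n k → suc n C suc k ≡ n C k + n C suc k
  C-pascal n k = sym (nCk+nC[k+1]≡[n+1]C[k+1] n k)

  C>0 : ∀ {n k} → k ≤ n → 1 ≤ n C k
  C>0 {n} {zero} _ = ≤-refl
  C>0 {suc n} {suc k} (s≤s k≤n) = subst (1 ≤_) (sym (C-pascal n k)) (≤-trans (C>0 k≤n) (m≤m+n _ _))

  C≤2^ : ∀ n k → n C k ≤ 2 ^ n
  C≤2^ n zero = m^n>0 2 n
  C≤2^ zero (suc k) = z≤n
  C≤2^ (suc n) (suc k) = begin
    suc n C suc k        ≡⟨ C-pascal n k ⟩
    n C k + n C suc k    ≤⟨ +-mono-≤ (C≤2^ n k) (C≤2^ n (suc k)) ⟩
    2 ^ n + 2 ^ n        ≡⟨ cong (2 ^ n +_) (sym (+-identityʳ (2 ^ n))) ⟩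
    2 ^ suc n ∎
    where open ≤-Reasoning

  C-mono : ∀ n k → n C k ≤ suc n C suc k
  C-mono n k = subst (n C k ≤_) (sym (C-pascal n k)) (m≤m+n _ _)

  C-monoˡ : ∀ n k → n C k ≤ suc n C k
  C-monoˡ n zero    = ≤-refl
  C-monoˡ n (suc k) = subst (n C suc k ≤_) (sym (C-pascal n k)) (m≤n+m _ _)

  2^≤central : ∀ m → 2 ^ m ≤ (m + m) C m
  2^≤central zero    = ≤-refl
  2^≤central (suc m) = begin
    2 ^ suc m                                  ≡⟨ cong (2 ^ m +_) (+-identityʳ (2 ^ m)) ⟩
    2 ^ m + 2 ^ m                              ≤⟨ +-mono-≤ (2^≤central m) (2^≤central m) ⟩
    (m + m) C m + (m + m) C m                  ≤⟨ +-mono-≤ (C-monoˡ (m + m) m) (C-mono (m + m) m) ⟩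
    suc (m + m) C m + suc (m + m) C suc m      ≡⟨ C-pascal (suc (m + m)) m ⟨
    suc (suc (m + m)) C suc m                  ≡⟨ cong (λ n → suc n C suc m) (sym (+-suc m m)) ⟩
    (suc m + suc m) C suc m ∎
    where open ≤-Reasoning

  C-factorial : ∀ {n k} → k ≤ n → (n C k) * (k ! * (n ∸ k) !) ≡ n !
  C-factorial {n} {k} k≤n = trans (cong (_* (k ! * (n ∸ k) !)) (nCk≡n!/k![n-k]! k≤n))
    (m/n*n≡m {{k !* (n ∸ k) !≢0}} (k![n∸k]!∣n! k≤n))

  C-absorb : ∀ {n k} → k ≤ n → suc k * (suc n C suc k) ≡ suc n * (n C k)
  C-absorb {n} {k} k≤n = *-cancelʳ-≡ _ _ (k ! * (n ∸ k) !) {{k !* (n ∸ k) !≢0}} (begin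
    suc k * c′ * (k ! * (n ∸ k) !)   ≡⟨ solve 4 (λ s c a b → s :* c :* (a :* b) := c :* (s :* a :* b)) refl (suc k) c′ (k !) ((n ∸ k) !) ⟩
    c′ * (suc k ! * (n ∸ k) !)       ≡⟨ C-factorial {suc n} {suc k} (s≤s k≤n) ⟩
    suc n * n !                      ≡⟨ cong (suc n *_) (C-factorial k≤n) ⟨
    suc n * ((n C k) * (k ! * (n ∸ k) !)) ≡⟨ *-assoc (suc n) (n C k) _ ⟨
    suc n * (n C k) * (k ! * (n ∸ k) !) ∎)
    where
    open ≡-Reasoning
    open +-*-Solver
    c′ = suc n C suc k

  -- The reciprocals of the entries of the Leibniz harmonic triangle.
  leibniz : ℕ → ℕ → ℕ
  leibniz n k = suc n * (n C k)

  -- Each entry of the harmonic triangle is the sum of the two below it, with denominators cleared;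
  -- Pascal's rule and `C-absorb` give it.
  leibniz-rule : ∀ {n k} → k ≤ n →
    leibniz n k * (leibniz (suc n) k + leibniz (suc n) (suc k)) ≡ leibniz (suc n) k * leibniz (suc n) (suc k)
  leibniz-rule {n} {k} k≤n = begin
    suc n * c₀ * (N * c₁ + N * c₂)  ≡⟨ cong (suc n * c₀ *_) (trans (sym (*-distribˡ-+ N c₁ c₂)) (cong (N *_) (sym (C-pascal (suc n) k)))) ⟩
    suc n * c₀ * (N * c₃)           ≡⟨ cong (_* (N * c₃)) (sym (C-absorb k≤n)) ⟩
    suc k * c₂ * (N * c₃)           ≡⟨ solve 4 (λ s a n b → s :* a :* (n :* b) := s :* b :* (n :* a)) refl (suc k) c₂ N c₃ ⟩
    suc k * c₃ * (N * c₂)           ≡⟨ cong (_* (N * c₂)) (C-absorb (m≤n⇒m≤1+n k≤n)) ⟩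
    N * c₁ * (N * c₂) ∎
    where
    open ≡-Reasoning
    open +-*-Solver
    N  = suc (suc n)
    c₀ = n C k
    c₁ = suc n C k
    c₂ = suc n C suc k
    c₃ = suc (suc n) C suc k

  -- 1/x = 1/y + 1/z, hence Z/z = Z/x - Z/y.
  harmonic-∣ : ∀ {x y z Z} → x ≢ 0 → x * (y + z) ≡ y * z → x ∣ Z → y ∣ Z → z ∣ Z
  harmonic-∣ {x} {y} {z} {Z} x≢0 rule (divides α Z≡αx) (divides β Z≡βy) =
    ∣m+n∣m⇒∣n (subst (z ∣_) αz≡ (n∣m*n α)) (n∣m*n β)
    where
    open ≡-Reasoning
    open +-*-Solver
    αz≡ : α * z ≡ β * z + Z
    αz≡ = *-cancelʳ-≡ _ _ x {{≢-nonZero x≢0}} (begin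
      α * z * x            ≡⟨ solve 3 (λ a z x → a :* z :* x := a :* x :* z) refl α z x ⟩
      α * x * z            ≡⟨ cong (_* z) (trans (sym Z≡αx) Z≡βy) ⟩
      β * y * z            ≡⟨ *-assoc β y z ⟩
      β * (y * z)          ≡⟨ cong (β *_) rule ⟨
      β * (x * (y + z))    ≡⟨ solve 4 (λ b x y z → b :* (x :* (y :+ z)) := (b :* z :+ b :* y) :* x) refl β x y z ⟩
      (β * z + β * y) * x  ≡⟨ cong (λ w → (β * z + w) * x) Z≡βy ⟨
      (β * z + Z) * x ∎)

  -- Column 0 consists of the numbers 1, ..., N themselves; by the rule, rows n and n + 1 of column
  -- k give row n + 1 of column k + 1.
  leibniz-∣ : ∀ {N Z} → (∀ m → 1 ≤ m → m ≤ N → m ∣ Z) → ∀ k n → k ≤ n → n < N → leibniz n k ∣ Z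
  leibniz-∣ {Z = Z} ∣Z zero n _ n<N = subst (_∣ Z) (sym (*-identityʳ (suc n))) (∣Z (suc n) (s≤s z≤n) n<N)
  leibniz-∣ {Z = Z} ∣Z (suc k) (suc n) (s≤s k≤n) n<N = harmonic-∣
    (m<n⇒n≢0 (*-mono-≤ (s≤s (z≤n {n})) (C>0 k≤n)))
    (leibniz-rule k≤n) (leibniz-∣ ∣Z k n k≤n (<⇒≤ n<N)) (leibniz-∣ ∣Z k (suc n) (m≤n⇒m≤1+n k≤n) n<N)

  prime∤1 : ∀ {p} → Prime p → ¬ p ∣ 1
  prime∤1 pr p∣1 = contradiction (∣1⇒≡1 p∣1) (m>1⇒m≢1 (nonTrivial⇒n>1 _ {{prime⇒nonTrivial pr}}))
    where
    m>1⇒m≢1 : ∀ {m} → 1 < m → m ≢ 1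
    m>1⇒m≢1 1<m refl = <-irrefl refl 1<m

  m∣n! : ∀ {m n} → 1 ≤ m → m ≤ n → m ∣ n !
  m∣n! {suc m} _ m≤n = ∣-trans (m∣m*n (m !)) (m≤n⇒m!∣n! m≤n)

  prime∤! : ∀ {p} → Prime p → ∀ {n} → n < p → ¬ p ∣ n !
  prime∤! pr {zero}  n<p p∣1 = prime∤1 pr p∣1
  prime∤! pr {suc n} n<p p∣ with euclidsLemma (suc n) (n !) pr p∣
  ... | inj₁ p∣1+n = >⇒∤ n<p p∣1+n
  ... | inj₂ p∣n!  = prime∤! pr (<⇒≤ n<p) p∣n!

  prime∣central : ∀ {p n} → Prime p → n < p → p ≤ n + n → p ∣ (n + n) C n
  prime∣central {p} {n} pr n<p p≤2n with euclidsLemma ((n + n) C n) (n ! * (n + n ∸ n) !) pr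
    (subst (p ∣_) (sym (C-factorial (m≤m+n n n))) (m∣n! (≤-trans (s≤s z≤n) n<p) p≤2n))
  ... | inj₁ p∣C = p∣C
  ... | inj₂ p∣!! with euclidsLemma (n !) ((n + n ∸ n) !) pr p∣!!
  ...   | inj₁ p∣n! = contradiction p∣n! (prime∤! pr n<p)
  ...   | inj₂ p∣n! = contradiction (subst (λ m → p ∣ m !) (m+n∸m≡n n n) p∣n!) (prime∤! pr n<p)

  primePart : ℕ → ℕ
  primePart m with prime? m
  ... | yes _ = m
  ... | no  _ = 1

  primePart-prime : ∀ {p} → Prime p → primePart p ≡ p
  primePart-prime {p} pr with prime? p
  ... | yes _  = refl
  ... | no ¬pr = contradiction pr ¬pr

  primePart-∣ : ∀ m → primePart m ∣ m
  primePart-∣ m with prime? m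
  ... | yes _ = ∣-refl
  ... | no  _ = 1∣ m

  primePart>0 : ∀ m → 1 ≤ primePart m
  primePart>0 m with prime? m
  ... | yes pr = >-nonZero⁻¹ m {{prime⇒nonZero pr}}
  ... | no  _  = ≤-refl

  -- The product of the primes in (n , n + k].
  primesIn : ℕ → ℕ → ℕ
  primesIn n zero    = 1
  primesIn n (suc k) = primePart (n + suc k) * primesIn n k

  primesIn>0 : ∀ n k → 1 ≤ primesIn n k
  primesIn>0 n zero    = ≤-refl
  primesIn>0 n (suc k) = *-mono-≤ (primePart>0 (n + suc k)) (primesIn>0 n k)

  primesIn-+ : ∀ n k → primesIn 0 (n + k) ≡ primesIn n k * primesIn 0 n
  primesIn-+ n zero    = trans (cong (primesIn 0) (+-identityʳ n)) (sym (+-identityʳ _))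
  primesIn-+ n (suc k) = begin
    primesIn 0 (n + suc k)                                ≡⟨ cong (primesIn 0) (+-suc n k) ⟩
    primePart (suc (n + k)) * primesIn 0 (n + k)          ≡⟨ cong₂ _*_ (cong primePart (sym (+-suc n k))) (primesIn-+ n k) ⟩
    primePart (n + suc k) * (primesIn n k * primesIn 0 n) ≡⟨ *-assoc (primePart (n + suc k)) _ _ ⟨
    primesIn n (suc k) * primesIn 0 n ∎
    where open ≡-Reasoning

  prime∣primesIn : ∀ {p} → Prime p → ∀ n → p ≤ n → p ∣ primesIn 0 n
  prime∣primesIn {p} pr zero    p≤0 = contradiction (subst (1 ≤_) (n≤0⇒n≡0 p≤0) (>-nonZero⁻¹ p {{prime⇒nonZero pr}})) λ ()
  prime∣primesIn {p} pr (suc n) p≤1+n with m≤n⇒m<n∨m≡n p≤1+n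
  ... | inj₁ (s≤s p≤n) = ∣n⇒∣m*n (primePart (suc n)) (prime∣primesIn pr n p≤n)
  ... | inj₂ refl      = ∣m⇒∣m*n (primesIn 0 n) (subst (p ∣_) (sym (primePart-prime pr)) ∣-refl)

  prime∤primesIn : ∀ {p} → Prime p → ∀ n k → n + k < p → ¬ p ∣ primesIn n k
  prime∤primesIn pr n zero    _   p∣1 = prime∤1 pr p∣1
  prime∤primesIn pr n (suc k) lt p∣ with euclidsLemma (primePart (n + suc k)) (primesIn n k) pr p∣
  ... | inj₁ p∣part = >⇒∤ {{>-nonZero (subst (0 <_) (sym (+-suc n k)) (s≤s z≤n))}} lt (∣-trans p∣part (primePart-∣ (n + suc k)))
  ... | inj₂ p∣rest = prime∤primesIn pr n k (<-trans (+-monoʳ-< n (n<1+n k)) lt) p∣rest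

  -- A new prime exceeds all those already collected, so it does not divide their product and, by
  -- Euclid's lemma, divides the cofactor.
  primesIn-∣ : ∀ {n M} k → (∀ {p} → Prime p → n < p → p ≤ n + k → p ∣ M) → primesIn n k ∣ M
  primesIn-∣ {M = M} zero    _  = 1∣ M
  primesIn-∣ {n} {M} (suc k) ∣M with primesIn-∣ {n} {M} k (λ pr n<p p≤ → ∣M pr n<p (≤-trans p≤ (+-monoʳ-≤ n (n≤1+n k))))
                                   | prime? (n + suc k)
  ... | rest∣M | no  _ = subst (_∣ M) (sym (*-identityˡ (primesIn n k))) rest∣M
  ... | divides q M≡ | yes pr with euclidsLemma q (primesIn n k) pr
                                  (subst (n + suc k ∣_) M≡ (∣M pr (m<m+n n (s≤s z≤n)) ≤-refl))
  ...   | inj₁ p∣q = subst ((n + suc k) * primesIn n k ∣_) (sym M≡) (*-monoˡ-∣ (primesIn n k) p∣q)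
  ...   | inj₂ p∣rest = contradiction p∣rest (prime∤primesIn pr n k (+-monoʳ-< n (n<1+n k)))

  primesIn-double : ∀ n → primesIn n n ≤ 2 ^ (n + n)
  primesIn-double n = ≤-trans
    (∣⇒≤ {{>-nonZero (C>0 (m≤m+n n n))}} (primesIn-∣ n λ pr → prime∣central pr))
    (C≤2^ (n + n) n)

  -- The primes in (n , 2n] multiply to at most 4^n, as their product divides a central binomial
  -- coefficient; over successive doublings the exponents add up geometrically.
  primorial-bound : ∀ k → primesIn 0 (2 ^ k) ≤ 2 ^ (2 * 2 ^ k)
  primorial-bound zero    = s≤s z≤n
  primorial-bound (suc k) = begin
    primesIn 0 (2 * n)               ≡⟨ cong (λ m → primesIn 0 (n + m)) (+-identityʳ n) ⟩
    primesIn 0 (n + n)               ≡⟨ primesIn-+ n n ⟩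
    primesIn n n * primesIn 0 n      ≤⟨ *-mono-≤ (primesIn-double n) (primorial-bound k) ⟩
    2 ^ (n + n) * 2 ^ (2 * n)        ≡⟨ ^-distribˡ-+-* 2 (n + n) (2 * n) ⟨
    2 ^ (n + n + 2 * n)              ≡⟨ cong (2 ^_) (solve 1 (λ n → n :+ n :+ con 2 :* n := con 2 :* (con 2 :* n)) refl n) ⟩
    2 ^ (2 * (2 * n)) ∎
    where
    open ≤-Reasoning
    open +-*-Solver
    n = 2 ^ k

  product-∣ : ∀ {M ps} → All (_∣ M) ps → product ps ∣ M ^ length ps
  product-∣ []           = ∣-refl
  product-∣ (p∣M ∷ ps∣M) = *-pres-∣ p∣M (product-∣ ps∣M)

  ^-∣ : ∀ M {i j} → i ≤ j → M ^ i ∣ M ^ j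
  ^-∣ M {j = j} z≤n = 1∣ (M ^ j)
  ^-∣ M (s≤s i≤j)   = *-monoʳ-∣ M (^-∣ M i≤j)

  2^length≤product : ∀ {ps} → All Prime ps → 2 ^ length ps ≤ product ps
  2^length≤product []         = ≤-refl
  2^length≤product (pr ∷ prs) = *-mono-≤ (nonTrivial⇒n>1 _ {{prime⇒nonTrivial pr}}) (2^length≤product prs)

  -- A number up to r² with a prime factor p > r is p times a number up to r.
  ∣primorial*r!^e : ∀ {x r e N} → N ≤ r * r → N ≤ 2 ^ e → 1 ≤ e →
                    (∀ {p} → Prime p → p ≤ N → p ≤ x) →
                    ∀ m → 1 ≤ m → m ≤ N → m ∣ primesIn 0 x * (r !) ^ e
  ∣primorial*r!^e {x} {r} {e} N≤r² N≤2^e 1≤e gap m@(suc _) 1≤m m≤N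
    with any? (λ p → r <? p) (PrimeFactorisation.factors (factorise m))
  -- Every prime factor now divides `r !`, and there are at most `e` of them because `m` is at most
  -- 2 ^ `e`.
  ... | no ¬large = ∣n⇒∣m*n (primesIn 0 x) (∣-trans m∣ (^-∣ (r !) length≤e))
    where
    open PrimeFactorisation (factorise m)
    small : All (_∣ r !) factors
    small = All.zipWith (λ (pr , p≯r) → m∣n! (>-nonZero⁻¹ _ {{prime⇒nonZero pr}}) (≮⇒≥ p≯r))
      (factorsPrime , ¬Any⇒All¬ factors ¬large)
    m∣ : m ∣ (r !) ^ length factors
    m∣ = subst (_∣ (r !) ^ length factors) (sym isFactorisation) (product-∣ small)
    length≤e : length factors ≤ e
    length≤e = ≮⇒≥ λ e<length → <⇒≱ (^-monoʳ-< 2 (s≤s (s≤s z≤n)) e<length) (begin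
      2 ^ length factors ≤⟨ 2^length≤product factorsPrime ⟩
      product factors    ≡⟨ isFactorisation ⟨
      m                  ≤⟨ m≤N ⟩
      _                  ≤⟨ N≤2^e ⟩
      2 ^ e ∎)
      where open ≤-Reasoning
  ... | yes large with find large
  ...   | p , p∈ , r<p with All.lookup (PrimeFactorisation.factorsPrime (factorise m)) p∈
                          | subst (p ∣_) (sym (PrimeFactorisation.isFactorisation (factorise m))) (∈⇒∣product p∈)
  ...     | pr | divides q m≡qp = subst (_∣ primesIn 0 x * (r !) ^ e) (trans (*-comm p q) (sym m≡qp))
    (*-pres-∣ (prime∣primesIn pr x (gap pr p≤N)) (∣-trans (m∣n! 1≤q q≤r) (subst (_∣ (r !) ^ e) (*-identityʳ (r !)) (^-∣ (r !) 1≤e))))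
    where
    p≤N : p ≤ _
    p≤N = ≤-trans (∣⇒≤ (divides q m≡qp)) m≤N
    1≤q : 1 ≤ q
    1≤q = n≢0⇒n>0 λ { refl → contradiction m≡qp λ () }
    q≤r : q ≤ r
    q≤r = ≮⇒≥ λ r<q → <⇒≱ (*-mono-< r<q r<p) (≤-trans (≤-reflexive (sym m≡qp)) (≤-trans m≤N N≤r²))

  n!≤ : ∀ {n r} → n ≤ r → n ! ≤ r ^ n
  n!≤ {zero}  _     = ≤-refl
  n!≤ {suc n} 1+n≤r = *-mono-≤ 1+n≤r (n!≤ (<⇒≤ 1+n≤r))

  -- The condition of `prime-between` for j = 9 + i; 9 is the least j that satisfies it.
  square≤2^ : ∀ i → 4 * ((11 + i) * (11 + i)) < 2 ^ (9 + i)
  square≤2^ zero    = toWitness {a? = 484 <? 512} _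
  square≤2^ (suc i) = begin-strict
    4 * ((11 + suc i) * (11 + suc i))   ≡⟨ solve 1 (λ i → con 4 :* ((con 12 :+ i) :* (con 12 :+ i)) := con 576 :+ con 96 :* i :+ con 4 :* (i :* i)) refl i ⟩
    576 + 96 * i + 4 * (i * i)          ≤⟨ +-mono-≤ (+-mono-≤ (toWitness {a? = 576 ≤? 968} _) (*-monoˡ-≤ i (toWitness {a? = 96 ≤? 176} _))) (*-monoˡ-≤ (i * i) (toWitness {a? = 4 ≤? 8} _)) ⟩
    968 + 176 * i + 8 * (i * i)         ≡⟨ solve 1 (λ i → con 968 :+ con 176 :* i :+ con 8 :* (i :* i) := con 2 :* (con 4 :* ((con 11 :+ i) :* (con 11 :+ i)))) refl i ⟩
    2 * (4 * ((11 + i) * (11 + i)))     <⟨ *-monoʳ-< 2 (square≤2^ i) ⟩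
    2 * 2 ^ (9 + i)                     ∎
    where
    open ≤-Reasoning
    open +-*-Solver

  2^2*suc : ∀ k → 2 ^ (2 * suc k) ≡ 4 * 2 ^ (2 * k)
  2^2*suc k = trans (cong (2 ^_) (cong suc (+-suc k (k + 0)))) (sym (*-assoc 2 2 (2 ^ (2 * k))))

  prime-between : ∀ {j} → 4 * (suc (suc j) * suc (suc j)) < 2 ^ j → ∃ λ p → Prime p × 2 ^ (2 * j) < p × p ≤ 4 * (4 * 2 ^ (2 * j))
  prime-between {j} j-large with anyUpTo? (λ p → (2 ^ (2 * j) <? p) ×-dec prime? p) (suc (2 ^ (2 * (suc (suc j)))))
  ... | yes (p , s≤s p≤N , x<p , pr) = p , pr , x<p , subst (p ≤_) (trans (2^2*suc (suc j)) (cong (4 *_) (2^2*suc j))) p≤N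
  ... | no ¬found = contradiction 2^h≤Z (<⇒≱ Z<2^h)
    where
    -- The bound for the primorial alone is 2 ^ (2 * x), so `h` must exceed 2 x, and row 2 `h` must
    -- lie below `N`, which has to be a square. Powers of four give `h` = 4 x and `N` = 16 x.
    x = 2 ^ (2 * j)
    s = suc (suc j)
    N = 2 ^ (2 * s)
    r = 2 ^ s
    h = 2 ^ (2 * (suc j))
    Z = primesIn 0 x * (r !) ^ (2 * s)
    instance
      Z≢0 : NonZero Z
      Z≢0 = m*n≢0 (primesIn 0 x) ((r !) ^ (2 * s)) {{>-nonZero (primesIn>0 0 x)}} {{m^n≢0 (r !) (2 * s) {{r !≢0}}}}
    gap : ∀ {p} → Prime p → p ≤ N → p ≤ x
    gap pr p≤N = ≮⇒≥ λ x<p → ¬found (_ , s≤s p≤N , x<p , pr)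
    N≡r² : N ≡ r * r
    N≡r² = trans (cong (2 ^_) (cong (s +_) (+-identityʳ s))) (^-distribˡ-+-* 2 s s)
    N≡4h : N ≡ 4 * h
    N≡4h = 2^2*suc (suc j)
    h≡4x : h ≡ 4 * x
    h≡4x = 2^2*suc j
    2^h≤Z : 2 ^ h ≤ Z
    2^h≤Z = begin
      2 ^ h                            ≤⟨ 2^≤central h ⟩
      (h + h) C h                      ≤⟨ m≤m+n ((h + h) C h) _ ⟩
      leibniz (h + h) h                ≤⟨ ∣⇒≤ (leibniz-∣ (∣primorial*r!^e {x} {r} {2 * s} (≤-reflexive N≡r²) ≤-refl (s≤s z≤n) gap) h (h + h) (m≤m+n h h) 2h<N) ⟩
      Z ∎
      where
      open ≤-Reasoning
      2h<N : h + h < N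
      2h<N = begin-strict
        h + h                ≡⟨ cong (h +_) (+-identityʳ h) ⟨
        2 * h                <⟨ *-monoˡ-< h {{m^n≢0 2 (2 * (suc j))}} (toWitness {a? = 2 <? 4} _) ⟩
        4 * h                ≡⟨ N≡4h ⟨
        N ∎
    x≡y² : x ≡ 2 ^ j * 2 ^ j
    x≡y² = trans (cong (2 ^_) (cong (j +_) (+-identityʳ j))) (^-distribˡ-+-* 2 j j)
    -- As `r` is 4 * 2 ^ j, the factorial contributes 8 s² 2 ^ j, which `j-large` makes smaller than
    -- 2 x; the primorial contributes the other 2 x.
    exponent : 2 * x + s * r * (2 * s) < h
    exponent = begin-strict
      2 * x + s * r * (2 * s)             ≡⟨ cong (λ w → 2 * x + s * w * (2 * s)) (sym (*-assoc 2 2 y)) ⟩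
      2 * x + s * (4 * y) * (2 * s)       ≡⟨ cong (2 * x +_) (solve 2 (λ s y → s :* (con 4 :* y) :* (con 2 :* s) := con 2 :* ((con 4 :* (s :* s)) :* y)) refl s y) ⟩
      2 * x + 2 * (4 * (s * s) * y)       <⟨ +-monoʳ-< (2 * x) (*-monoʳ-< 2 (*-monoˡ-< y {{m^n≢0 2 j}} j-large)) ⟩
      2 * x + 2 * (y * y)                 ≡⟨ cong (λ w → 2 * x + 2 * w) x≡y² ⟨
      2 * x + 2 * x                       ≡⟨ solve 1 (λ x → con 2 :* x :+ con 2 :* x := con 4 :* x) refl x ⟩
      4 * x                               ≡⟨ h≡4x ⟨
      h ∎
      where
      open ≤-Reasoning
      open +-*-Solver
      y = 2 ^ j
    Z<2^h : Z < 2 ^ h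
    Z<2^h = begin-strict
      primesIn 0 x * (r !) ^ (2 * s)      ≤⟨ *-mono-≤ (primorial-bound (2 * j)) (^-monoˡ-≤ (2 * s) (n!≤ {r} ≤-refl)) ⟩
      2 ^ (2 * x) * (r ^ r) ^ (2 * s)     ≡⟨ cong (2 ^ (2 * x) *_) (trans (cong (_^ (2 * s)) (^-*-assoc 2 s r)) (^-*-assoc 2 (s * r) (2 * s))) ⟩
      2 ^ (2 * x) * 2 ^ (s * r * (2 * s)) ≡⟨ ^-distribˡ-+-* 2 (2 * x) (s * r * (2 * s)) ⟨
      2 ^ (2 * x + s * r * (2 * s))       <⟨ ^-monoʳ-< 2 (s≤s (s≤s z≤n)) exponent ⟩
      2 ^ h ∎
      where open ≤-Reasoning

-- The incidence graph of points and lines over ℤ/p.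

module IncidenceGraph where
  open import Data.Empty using (⊥)
  open import Data.Fin using (fromℕ<; combine; _↑ˡ_; _↑ʳ_; remQuot)
  open import Data.List using (lookup)
  open import Data.List.Relation.Unary.Any.Properties using (lookup-index)
  open import Data.Nat using (_+_; _*_; _∸_; _≤_; _<_; NonZero)
  open import Data.Nat.DivMod using (_%_; m%n<n; m%n%n≡m%n; %-distribˡ-+; n%n≡0; m%n≤n)
  open import Data.Nat.Divisibility using (_∣_; _∣?_; ∣m+n∣m⇒∣n; ∣m∣n⇒∣m+n; m%n≡0⇒n∣m; >⇒∤)
  open import Data.Nat.Primality using (euclidsLemma; prime⇒nonZero)
  open import Data.Nat.Properties
  open import Data.Nat.Solver using (module +-*-Solver)
  open import Data.Sum.Function.Propositional using (_⊎-↔_)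
  open import Function using (Injection)
  open import Function.Properties.Inverse using (↔-refl; ↔-sym; ↔-trans; ↔⇒↣)

  injective⇒≤length : ∀ {A : Set} {k} {f : Fin k → A} {xs} → Injective _≡_ _≡_ f → (∀ i → f i ∈ xs) → k ≤ length xs
  injective⇒≤length {f = f} {xs} inj f∈ = Fin.injective⇒≤ {f = Any.index ∘ f∈} λ {i} {j} eq →
    inj (trans (lookup-index (f∈ i)) (trans (cong (lookup xs) eq) (sym (lookup-index (f∈ j)))))

  -- Consecutive vertices of the closed walk differ by irreflexivity, so distinct diagonals make it
  -- a 4-cycle.
  C₄-Free : Graph → Set
  C₄-Free G = ∀ {u v x y} → Adj u v → Adj v x → Adj x y → Adj y u → u ≢ x → v ≢ y → ⊥
    where open Graph G

  □-hasEdge : ∀ {T S} → HasEdge T → HasEdge S → HasEdge (T □ S)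
  □-hasEdge (u , _) (v , v′ , v~v′) = (u , v) , (u , v′) , inj₁ (refl , v~v′)

  C₄-free⇒□-free : ∀ {T S G} → HasEdge T → HasEdge S → C₄-Free G → ¬ (T □ S) ⊑ G
  C₄-free⇒□-free {T} {S} (u , v , u~v) (x , y , x~y) free (f , inj , hom) = free
    (hom {u , x} {v , x} (inj₂ (refl , u~v)))
    (hom {v , x} {v , y} (inj₁ (refl , x~y)))
    (hom {v , y} {u , y} (inj₂ (refl , Graph.symmetric T u~v)))
    (hom {u , y} {u , x} (inj₁ (refl , Graph.symmetric S x~y)))
    (λ eq → u≢v (,-injectiveˡ (inj eq)))
    (λ eq → u≢v (sym (,-injectiveˡ (inj eq))))
    where
    u≢v : u ≢ v
    u≢v u≡v = Graph.irreflexive T u≡v u~v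

  <∧∣⇒≡0 : ∀ {p m} → m < p → p ∣ m → m ≡ 0
  <∧∣⇒≡0 {m = zero}  _   _   = refl
  <∧∣⇒≡0 {m = suc m} m<p p∣m = contradiction p∣m (>⇒∤ m<p)

  ∣+-unique-≤ : ∀ {p} k {b c} → p ∣ k + b → p ∣ k + c → c < p → b ≤ c → b ≡ c
  ∣+-unique-≤ {p} k {b} {c} p∣b p∣c c<p b≤c = ≤-antisym b≤c (m∸n≡0⇒m≤n (<∧∣⇒≡0 (≤-<-trans (m∸n≤m c b) c<p)
    (∣m+n∣m⇒∣n (subst (p ∣_) (trans (cong (k +_) (sym (m+[n∸m]≡n b≤c))) (sym (+-assoc k b (c ∸ b)))) p∣c) p∣b)))

  ∣+-unique : ∀ {p} k {b c} → p ∣ k + b → p ∣ k + c → b < p → c < p → b ≡ c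
  ∣+-unique k {b} {c} p∣b p∣c b<p c<p with ≤-total b c
  ... | inj₁ b≤c = ∣+-unique-≤ k p∣b p∣c c<p b≤c
  ... | inj₂ c≤b = sym (∣+-unique-≤ k p∣c p∣b b<p c≤b)

  complement : ∀ p .{{_ : NonZero p}} k → ∃ λ (b : Fin p) → p ∣ k + toℕ b
  -- The outer remainder matters when `r` is 0, where `p ∸ r` is out of range.
  complement p k = fromℕ< (m%n<n (p ∸ r) p) , m%n≡0⇒n∣m _ p (begin
    (k + toℕ (fromℕ< (m%n<n (p ∸ r) p))) % p ≡⟨ cong (λ b → (k + b) % p) (Fin.toℕ-fromℕ< (m%n<n (p ∸ r) p)) ⟩
    (k + (p ∸ r) % p) % p                    ≡⟨ %-distribˡ-+ k _ p ⟩
    (r + (p ∸ r) % p % p) % p                ≡⟨ cong₂ (λ b c → (b + c) % p) (sym (m%n%n≡m%n k p)) (m%n%n≡m%n (p ∸ r) p) ⟩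
    (r % p + (p ∸ r) % p) % p                ≡⟨ %-distribˡ-+ r (p ∸ r) p ⟨
    (r + (p ∸ r)) % p                        ≡⟨ cong (_% p) (m+[n∸m]≡n (m%n≤n k p)) ⟩
    p % p                                    ≡⟨ n%n≡0 p ⟩
    0 ∎)
    where
    open ≡-Reasoning
    r = k % p

  module _ (p : ℕ) (prime : Prime p) where
    instance
      p≢0 : NonZero p
      p≢0 = prime⇒nonZero prime

    Pair : Set
    Pair = Fin p × Fin p

    -- The point (x , y) lies on the line y = - m x - b.
    Incident : Pair → Pair → Set
    Incident (x , y) (m , b) = p ∣ toℕ m * toℕ x + toℕ y + toℕ b

    -- (m′ - m) (x′ - x) vanishes modulo p.
    rectangle : ∀ {m m′ x x′ y y′ b b′} → m ≤ m′ → x ≤ x′ → m′ < p → x′ < p →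
                p ∣ m * x + y + b → p ∣ m * x′ + y′ + b → p ∣ m′ * x + y + b′ → p ∣ m′ * x′ + y′ + b′ →
                m ≡ m′ ⊎ x ≡ x′
    rectangle {m} {m′} {x} {x′} {y} {y′} {b} {b′} m≤m′ x≤x′ m′<p x′<p i₁ i₂ i₃ i₄
      with euclidsLemma (m′ ∸ m) (x′ ∸ x) prime
        (∣m+n∣m⇒∣n (subst (p ∣_) identity (∣m∣n⇒∣m+n i₁ i₄)) (∣m∣n⇒∣m+n i₂ i₃))
      where
      open ≡-Reasoning
      open +-*-Solver
      e = m′ ∸ m
      f = x′ ∸ x
      -- In the alternating sum of the four incidences y, y′, b and b′ cancel; the negative terms
      -- are moved across to stay in ℕ.
      identity : (m * x + y + b) + (m′ * x′ + y′ + b′) ≡ ((m * x′ + y′ + b) + (m′ * x + y + b′)) + e * f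
      identity = begin
        (m * x + y + b) + (m′ * x′ + y′ + b′)
          ≡⟨ cong₂ (λ m′ x′ → (m * x + y + b) + (m′ * x′ + y′ + b′)) (m+[n∸m]≡n m≤m′) (m+[n∸m]≡n x≤x′) ⟨
        (m * x + y + b) + ((m + e) * (x + f) + y′ + b′)
          ≡⟨ solve 8 (λ m e x f y y′ b b′ → (m :* x :+ y :+ b) :+ ((m :+ e) :* (x :+ f) :+ y′ :+ b′) :=
               ((m :* (x :+ f) :+ y′ :+ b) :+ ((m :+ e) :* x :+ y :+ b′)) :+ e :* f) refl m e x f y y′ b b′ ⟩
        ((m * (x + f) + y′ + b) + ((m + e) * x + y + b′)) + e * f
          ≡⟨ cong₂ (λ m′ x′ → ((m * x′ + y′ + b) + (m′ * x + y + b′)) + e * f) (m+[n∸m]≡n m≤m′) (m+[n∸m]≡n x≤x′) ⟩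
        ((m * x′ + y′ + b) + (m′ * x + y + b′)) + e * f ∎
    ... | inj₁ p∣e = inj₁ (≤-antisym m≤m′ (m∸n≡0⇒m≤n (<∧∣⇒≡0 (≤-<-trans (m∸n≤m m′ m) m′<p) p∣e)))
    ... | inj₂ p∣f = inj₂ (≤-antisym x≤x′ (m∸n≡0⇒m≤n (<∧∣⇒≡0 (≤-<-trans (m∸n≤m x′ x) x′<p) p∣f)))

    same-slope-or-abscissa : ∀ {P P′ L L′} → Incident P L → Incident P′ L → Incident P L′ → Incident P′ L′ →
                             proj₁ L ≡ proj₁ L′ ⊎ proj₁ P ≡ proj₁ P′
    same-slope-or-abscissa {x , _} {x′ , _} {m , _} {m′ , _} i₁ i₂ i₃ i₄
      with ≤-total (toℕ m) (toℕ m′) | ≤-total (toℕ x) (toℕ x′)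
    ... | inj₁ m≤ | inj₁ x≤ = Sum.map Fin.toℕ-injective Fin.toℕ-injective
      (rectangle m≤ x≤ (Fin.toℕ<n m′) (Fin.toℕ<n x′) i₁ i₂ i₃ i₄)
    ... | inj₁ m≤ | inj₂ x≤ = Sum.map Fin.toℕ-injective (sym ∘ Fin.toℕ-injective)
      (rectangle m≤ x≤ (Fin.toℕ<n m′) (Fin.toℕ<n x) i₂ i₁ i₄ i₃)
    ... | inj₂ m≤ | inj₁ x≤ = Sum.map (sym ∘ Fin.toℕ-injective) Fin.toℕ-injective
      (rectangle m≤ x≤ (Fin.toℕ<n m) (Fin.toℕ<n x′) i₃ i₄ i₁ i₂)
    ... | inj₂ m≤ | inj₂ x≤ = Sum.map (sym ∘ Fin.toℕ-injective) (sym ∘ Fin.toℕ-injective)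
      (rectangle m≤ x≤ (Fin.toℕ<n m) (Fin.toℕ<n x) i₄ i₃ i₂ i₁)

    -- Two lines of equal slope with a common point coincide, and so do two points of one line with
    -- equal abscissae.
    no-rectangle : ∀ {P P′ L L′} → Incident P L → Incident P′ L → Incident P L′ → Incident P′ L′ →
                   P ≢ P′ → L ≢ L′ → ⊥
    no-rectangle {x , y} {x′ , y′} {m , b} {m′ , b′} i₁ i₂ i₃ i₄ P≢P′ L≢L′
      with same-slope-or-abscissa {x , y} {x′ , y′} {m , b} {m′ , b′} i₁ i₂ i₃ i₄
    ... | inj₁ refl = L≢L′ (cong (m ,_) (Fin.toℕ-injective
      (∣+-unique (toℕ m * toℕ x + toℕ y) i₁ i₃ (Fin.toℕ<n b) (Fin.toℕ<n b′))))
    ... | inj₂ refl = P≢P′ (cong (x ,_) (Fin.toℕ-injective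
      (∣+-unique (toℕ m * toℕ x + toℕ b) (swap y i₁) (swap y′ i₂) (Fin.toℕ<n y) (Fin.toℕ<n y′))))
      where
      open +-*-Solver
      swap : ∀ (z : Fin p) → p ∣ toℕ m * toℕ x + toℕ z + toℕ b → p ∣ toℕ m * toℕ x + toℕ b + toℕ z
      swap z = subst (p ∣_) (solve 3 (λ k z b → k :+ z :+ b := k :+ b :+ z) refl (toℕ m * toℕ x) (toℕ z) (toℕ b))

    module _ (q : ℕ) where

      PlaneV : Set
      PlaneV = Pair ⊎ (Pair ⊎ Fin q)

      PlaneAdj : PlaneV → PlaneV → Set
      PlaneAdj (inj₁ P)        (inj₂ (inj₁ L)) = Incident P L
      PlaneAdj (inj₂ (inj₁ L)) (inj₁ P)        = Incident P L
      PlaneAdj _               _               = ⊥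

      planeAdj? : ∀ u v → Dec (PlaneAdj u v)
      planeAdj? (inj₁ (x , y))        (inj₂ (inj₁ (m , b))) = p ∣? _
      planeAdj? (inj₂ (inj₁ (m , b))) (inj₁ (x , y))        = p ∣? _
      planeAdj? (inj₁ _)        (inj₁ _)        = no λ ()
      planeAdj? (inj₁ _)        (inj₂ (inj₂ _)) = no λ ()
      planeAdj? (inj₂ (inj₁ _)) (inj₂ _)        = no λ ()
      planeAdj? (inj₂ (inj₂ _)) _               = no λ ()

      plane-symmetric : ∀ {u v} → PlaneAdj u v → PlaneAdj v u
      plane-symmetric {inj₁ P}        {inj₂ (inj₁ L)} i = i
      plane-symmetric {inj₂ (inj₁ L)} {inj₁ P}        i = i

      plane-irreflexive : ∀ {u v} → u ≡ v → ¬ PlaneAdj u v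
      plane-irreflexive {inj₁ P}        refl ()
      plane-irreflexive {inj₂ (inj₁ L)} refl ()
      plane-irreflexive {inj₂ (inj₂ i)} refl ()

      -- The q isolated vertices serve to reach every large order.
      plane : Graph
      plane = record
        { V           = PlaneV
        ; order       = p * p + (p * p + q)
        ; enum        = ↔-trans (↔-sym Fin.*↔× ⊎-↔ ↔-trans (↔-sym Fin.*↔× ⊎-↔ ↔-refl) (↔-sym Fin.+↔⊎)) (↔-sym Fin.+↔⊎)
        ; Adj         = PlaneAdj
        ; _adj?_      = planeAdj?
        ; symmetric   = λ {u} {v} → plane-symmetric {u} {v}
        ; irreflexive = plane-irreflexive
        }

      plane-C₄-free : C₄-Free plane
      plane-C₄-free {inj₁ P} {inj₂ (inj₁ L)} {inj₁ P′} {inj₂ (inj₁ L′)} i₁ i₂ i₃ i₄ u≢x v≢y =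
        no-rectangle {P} {P′} {L} {L′} i₁ i₂ i₄ i₃ (u≢x ∘ cong inj₁) (v≢y ∘ cong (inj₂ ∘ inj₁))
      plane-C₄-free {inj₂ (inj₁ L)} {inj₁ P} {inj₂ (inj₁ L′)} {inj₁ P′} i₁ i₂ i₃ i₄ u≢x v≢y =
        no-rectangle {P} {P′} {L} {L′} i₁ i₄ i₂ i₃ (v≢y ∘ cong inj₁) (u≢x ∘ cong (inj₂ ∘ inj₁))

      open Graph plane using (index; vertex-index; index-injective)

      -- A slope and a point determine the line through that point, which gives p³ edges.
      edge : Fin p × Pair → Fin (Graph.order plane) × Fin (Graph.order plane)
      edge (m , x , y) = index (inj₁ (x , y)) , index (inj₂ (inj₁ (m , proj₁ (complement p (toℕ m * toℕ x + toℕ y)))))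

      edge-injective : Injective _≡_ _≡_ edge
      edge-injective {m , x , y} {m′ , x′ , y′} eq
        with index-injective {inj₁ (x , y)} {inj₁ (x′ , y′)} (,-injectiveˡ eq)
           | index-injective {inj₂ (inj₁ (m , _))} {inj₂ (inj₁ (m′ , _))} (,-injectiveʳ eq)
      ... | refl | eq′ = cong (λ m → m , x , y) (cong slope eq′)
        where
        slope : PlaneV → Fin p
        slope (inj₂ (inj₁ (m , _))) = m
        slope _                     = m

      edge-listed : ∀ t → edge t ∈ _
      edge-listed t@(m , x , y) = ∈-filter⁺ (λ (i , j) → planeAdj? (Graph.vertex plane i) (Graph.vertex plane j))
        (∈-filter⁺ (λ (i , j) → i Fin.<? j)
          (∈-cartesianProduct⁺ (∈-allFin (proj₁ (edge t))) (∈-allFin (proj₂ (edge t)))) ordered)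
        (subst₂ PlaneAdj (sym (vertex-index (inj₁ (x , y)))) (sym (vertex-index (inj₂ (inj₁ (m , _)))))
          (proj₂ (complement p (toℕ m * toℕ x + toℕ y))))
        where
        b = proj₁ (complement p (toℕ m * toℕ x + toℕ y))
        -- Points are enumerated before lines, so the pair is in the increasing order that `pairs`
        -- requires.
        ordered : toℕ (combine x y ↑ˡ (p * p + q)) < toℕ (p * p ↑ʳ (combine m b ↑ˡ q))
        ordered = subst₂ _<_ (sym (Fin.toℕ-↑ˡ (combine x y) (p * p + q))) (sym (Fin.toℕ-↑ʳ (p * p) (combine m b ↑ˡ q)))
          (<-≤-trans (Fin.toℕ<n (combine x y)) (m≤m+n (p * p) _))

      plane-edges : p * (p * p) ≤ edgeCount plane
      plane-edges = injective⇒≤length {f = λ i → edge (triple i)}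
        (λ eq → triple-injective (edge-injective eq)) (λ i → edge-listed (triple i))
        where
        triple : Fin (p * (p * p)) → Fin p × Pair
        triple i = proj₁ (remQuot {p} (p * p) i) , remQuot {p} p (proj₂ (remQuot {p} (p * p) i))
        remQuot-injective : ∀ m n {i j : Fin (m * n)} → remQuot {m} n i ≡ remQuot {m} n j → i ≡ j
        remQuot-injective m n = Injection.injective (↔⇒↣ (Fin.*↔× {m} {n}))
        triple-injective : Injective _≡_ _≡_ triple
        triple-injective eq = remQuot-injective p (p * p)
          (cong₂ _,_ (,-injectiveˡ eq) (remQuot-injective p p (,-injectiveʳ eq)))

-- The two bounds and their constants.

module Bounds where
  open RationalSums
  open RandomGrid hiding (root; extend)
  open TreeLabelling
  open PrimeGaps
  open IncidenceGraph
  open import Data.List using (filter; tabulate; allFin; cartesianProduct)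
  open import Data.Nat using (_^_)
  open import Data.Rational using (ℚ; 0ℚ; 1ℚ; _+_; _*_; _≤_; _<_)
  open import Data.Rational.Properties hiding (_≟_)
  open import Data.Rational.Solver using (module +-*-Solver)

  listSum : ∀ {A : Set} → (A → ℚ) → List A → ℚ
  listSum f []       = 0ℚ
  listSum f (x ∷ xs) = f x + listSum f xs

  listSum-map : ∀ {A B : Set} (f : B → ℚ) (g : A → B) xs → listSum f (map g xs) ≡ listSum (f ∘ g) xs
  listSum-map f g []       = refl
  listSum-map f g (x ∷ xs) = cong (f (g x) +_) (listSum-map f g xs)

  listSum-++ : ∀ {A : Set} (f : A → ℚ) xs ys → listSum f (xs ++ ys) ≡ listSum f xs + listSum f ys
  listSum-++ f []       ys = sym (+-identityˡ _)
  listSum-++ f (x ∷ xs) ys = trans (cong (f x +_) (listSum-++ f xs ys)) (sym (+-assoc (f x) _ _))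

  listSum-tabulate : ∀ {A : Set} {n} (f : A → ℚ) (g : Fin n → A) → listSum f (tabulate g) ≡ sum (f ∘ g)
  listSum-tabulate {n = zero}  f g = refl
  listSum-tabulate {n = suc n} f g = cong (f (g zero) +_) (listSum-tabulate f (g ∘ suc))

  listSum-cartesianProduct : ∀ {A B : Set} (f : A × B → ℚ) xs ys →
    listSum f (cartesianProduct xs ys) ≡ listSum (λ x → listSum (λ y → f (x , y)) ys) xs
  listSum-cartesianProduct f []       ys = refl
  listSum-cartesianProduct f (x ∷ xs) ys = trans (listSum-++ f (map (x ,_) ys) _)
    (cong₂ _+_ (listSum-map f (x ,_) ys) (listSum-cartesianProduct f xs ys))

  length-filter≤listSum : ∀ {A : Set} {P Q : A → Set} (P? : U.Decidable P) (Q? : U.Decidable Q) {f : A → ℚ} →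
    (∀ x → 0ℚ ≤ f x) → (∀ {x} → P x → 1ℚ ≤ f x) →
    ∀ xs → ι (length (filter P? (filter Q? xs))) ≤ listSum f xs
  length-filter≤listSum P? Q? 0≤f 1≤f [] = ≤-reflexive ι-0
  length-filter≤listSum P? Q? 0≤f 1≤f (x ∷ xs) with Q? x
  ... | no  _ = ≤-trans (length-filter≤listSum P? Q? 0≤f 1≤f xs) (q≤p+q (0≤f x))
  ... | yes _ with P? x
  ...   | no  _  = ≤-trans (length-filter≤listSum P? Q? 0≤f 1≤f xs) (q≤p+q (0≤f x))
  ...   | yes px = ≤-trans (≤-reflexive (ι-suc (length (filter P? (filter Q? xs)))))
    (+-mono-≤ (1≤f px) (length-filter≤listSum P? Q? 0≤f 1≤f xs))

  bracket : ∀ (f : ℕ → ℕ) {n} k → f 0 ℕ.≤ n → n ℕ.< f k → ∃ λ i → f i ℕ.≤ n × n ℕ.< f (suc i)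
  bracket f zero    f0≤n n<f0 = contradiction n<f0 (ℕ.≤⇒≯ f0≤n)
  bracket f {n} (suc k) f0≤n n<f with n ℕ.<? f k
  ... | yes n<fk = bracket f k f0≤n n<fk
  ... | no  n≮fk = k , ℕ.≮⇒≥ n≮fk , n<f

  integer-sqrt : ∀ n → ∃ λ ℓ → ℓ ℕ.* ℓ ℕ.≤ n × n ℕ.< suc ℓ ℕ.* suc ℓ
  integer-sqrt n = bracket (λ ℓ → ℓ ℕ.* ℓ) (suc n) z≤n (ℕ.m≤m*n (suc n) (suc n))

  module _ (G : Graph) where
    open Graph G
    private
      n = order

    _~_ : Fin n → Fin n → Set
    i ~ j = Adj (vertex i) (vertex j)

    _~?_ : ∀ i j → Dec (i ~ j)
    i ~? j = vertex i adj? vertex j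

    Embedding : List Pos → Set
    Embedding C = ∃ λ (x : Pos → Fin n) → (∀ {p q} → q ∈ C → p ◁ q → x p ~ x q) ×
                                          (∀ {p q} → p ∈ C → q ∈ C → x p ≡ x q → p ≡ q)

    open RandomWalk {n} {_~_} _~?_ symmetric using (a; d; a-nonneg; a-adj)

    edgeCount≤degrees : ι (edgeCount G) ≤ sum d
    edgeCount≤degrees = ≤-trans
      (length-filter≤listSum (λ (i , j) → i ~? j) (λ (i , j) → i Fin.<? j) (λ (i , j) → a-nonneg i j)
        (λ i~j → ≤-reflexive (sym (a-adj i~j))) (cartesianProduct (allFin n) (allFin n)))
      (≤-reflexive (trans (listSum-cartesianProduct (λ (i , j) → a i j) (allFin n) (allFin n))
        (trans (listSum-tabulate (λ i → listSum (a i) (allFin n)) id)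
          (sum-cong-≗ λ i → listSum-tabulate (a i) id))))

    module _ (ℓ : ℕ) (1≤ℓ : 1 ℕ.≤ ℓ) (n≤4ℓ² : n ℕ.≤ 4 ℕ.* (ℓ ℕ.* ℓ)) where
      private
        L  = ι ℓ
        μ  = inv L
        F  = ι n

      1≤L : 1ℚ ≤ L
      1≤L = subst (_≤ L) ι-1 (ι-mono 1≤ℓ)

      0≤L : 0ℚ ≤ L
      0≤L = ι-nonneg ℓ

      L≢0 : L ≢ 0ℚ
      L≢0 L≡0 = <-irrefl refl (<-≤-trans (positive⁻¹ 1ℚ) (subst (1ℚ ≤_) L≡0 1≤L))

      Lμ≡1 : L * μ ≡ 1ℚ
      Lμ≡1 = *-inv L≢0

      ε′ : ℚ
      ε′ = ε _~?_ symmetric 1≤L (inv-nonneg 0≤L) Lμ≡1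

      F≤ : F ≤ ι 4 * (L * L)
      F≤ = subst (F ≤_) (trans (ι-* 4 (ℓ ℕ.* ℓ)) (cong (ι 4 *_) (ι-* ℓ ℓ))) (ι-mono n≤4ℓ²)

      -- From n ≤ 4 ℓ² the term n² / ℓ is at most 4 ℓ n; together with ℓ n this makes 5 ℓ n.
      ε≤ : ε′ ≤ ι (5 ℕ.* (ℓ ℕ.* n))
      ε≤ = begin
        L * ∑₁ + μ * ∑₂                     ≡⟨ cong₂ (λ y z → L * y + μ * z) ∑₁≡ (trans (sum-const n ∑₁) (cong (F *_) ∑₁≡)) ⟩
        L * F + μ * (F * F)                 ≤⟨ +-monoʳ-≤ (L * F) (*-mono-≤ˡ (inv-nonneg 0≤L) (*-mono-≤ʳ (ι-nonneg n) F≤)) ⟩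
        L * F + μ * (ι 4 * (L * L) * F) ≡⟨ cong (L * F +_) (solve 4 (λ m c l f → m :* (c :* (l :* l) :* f) := (l :* m) :* (c :* (l :* f))) refl μ (ι 4) L F) ⟩
        L * F + (L * μ) * (ι 4 * (L * F)) ≡⟨ cong₂ _+_ (sym (*-identityˡ (L * F))) (trans (cong (_* (ι 4 * (L * F))) Lμ≡1) (*-identityˡ _)) ⟩
        1ℚ * (L * F) + ι 4 * (L * F)   ≡⟨ *-distribʳ-+ (L * F) 1ℚ (ι 4) ⟨
        (1ℚ + ι 4) * (L * F)           ≡⟨ cong₂ _*_ (sym (ι-suc 4)) (sym (ι-* ℓ n)) ⟩
        ι 5 * ι (ℓ ℕ.* n)         ≡⟨ ι-* 5 (ℓ ℕ.* n) ⟨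
        ι (5 ℕ.* (ℓ ℕ.* n)) ∎
        where
        open ≤-Reasoning
        open +-*-Solver
        ∑₁ ∑₂ : ℚ
        ∑₁ = sum {n} λ _ → 1ℚ
        ∑₂ = sum {n} λ _ → ∑₁
        ∑₁≡ : ∑₁ ≡ F
        ∑₁≡ = trans (sum-const n 1ℚ) (*-identityʳ F)

      dense⇒embedding : ∀ {C} → Ordered C → length C ℕ.* length C ℕ.* (5 ℕ.* (ℓ ℕ.* n)) ℕ.< edgeCount G → Embedding C
      dense⇒embedding {C} o dense = embedding _~?_ symmetric 1≤L (inv-nonneg 0≤L) Lμ≡1 o (begin-strict
        ι N * ι N * ε′
          ≡⟨ cong (_* ε′) (ι-* N N) ⟨
        ι (N ℕ.* N) * ε′
          ≤⟨ *-mono-≤ˡ (ι-nonneg (N ℕ.* N)) ε≤ ⟩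
        ι (N ℕ.* N) * ι (5 ℕ.* (ℓ ℕ.* n))
          ≡⟨ ι-* (N ℕ.* N) (5 ℕ.* (ℓ ℕ.* n)) ⟨
        ι (N ℕ.* N ℕ.* (5 ℕ.* (ℓ ℕ.* n)))
          <⟨ ι-mono-< dense ⟩
        ι (edgeCount G)
          ≤⟨ edgeCount≤degrees ⟩
        sum d ∎)
        where
        open ≤-Reasoning
        N = length C

  -- As ℓ is at most the square root of n, e is O(n^(3/2)), stated here after squaring. The
  -- successor keeps the constant positive.
  square-bound : ∀ N ℓ {n e} → ℓ ℕ.* ℓ ℕ.≤ n → e ℕ.≤ N ℕ.* N ℕ.* (5 ℕ.* (ℓ ℕ.* n)) →
                 e ^ 2 ℕ.≤ (suc (N ℕ.* N ℕ.* 5) ℕ.* suc (N ℕ.* N ℕ.* 5)) ℕ.* n ^ 3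
  square-bound N ℓ {n} {e} ℓ²≤n e≤ = begin
    e ^ 2                               ≤⟨ ℕ.^-monoˡ-≤ 2 e≤′ ⟩
    (B ℕ.* (ℓ ℕ.* n)) ^ 2               ≡⟨ square B ℓ n ⟩
    (B ℕ.* B) ℕ.* ((ℓ ℕ.* ℓ) ℕ.* n ^ 2) ≤⟨ ℕ.*-monoʳ-≤ (B ℕ.* B) (ℕ.*-monoˡ-≤ (n ^ 2) ℓ²≤n) ⟩
    (B ℕ.* B) ℕ.* n ^ 3 ∎
    where
    open ℕ.≤-Reasoning
    open Data.Nat.Solver.+-*-Solver
    B = suc (N ℕ.* N ℕ.* 5)
    square : ∀ b l n → (b ℕ.* (l ℕ.* n)) ^ 2 ≡ (b ℕ.* b) ℕ.* ((l ℕ.* l) ℕ.* n ^ 2)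
    square = solve 3 (λ b l n → (b :* (l :* n)) :^ 2 := (b :* b) :* ((l :* l) :* n :^ 2)) refl
    e≤′ : e ℕ.≤ B ℕ.* (ℓ ℕ.* n)
    e≤′ = begin
      e                                 ≤⟨ e≤ ⟩
      N ℕ.* N ℕ.* (5 ℕ.* (ℓ ℕ.* n))     ≡⟨ ℕ.*-assoc (N ℕ.* N) 5 (ℓ ℕ.* n) ⟨
      N ℕ.* N ℕ.* 5 ℕ.* (ℓ ℕ.* n)       ≤⟨ ℕ.*-monoˡ-≤ (ℓ ℕ.* n) (ℕ.n≤1+n (N ℕ.* N ℕ.* 5)) ⟩
      B ℕ.* (ℓ ℕ.* n) ∎

  module Copy (T S : Graph) (lT : Labelling T) (lS : Labelling S) where
    open Labelling lT renaming (nodes to nodesT; isClosed to closedT; node to nodeT; node∈ to nodeT∈; injective to injectiveT; parent to parentT)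
    open Labelling lS renaming (nodes to nodesS; isClosed to closedS; node to nodeS; node∈ to nodeS∈; injective to injectiveS; parent to parentS)

    positions : List Pos
    positions = grid nodesT nodesS

    position∈ : ∀ u v → (nodeT u , nodeS v) ∈ positions
    position∈ u v = ∈-cartesianProductWith⁺ pos (nodeS∈ v) (nodeT∈ u)

    N B : ℕ
    N = length positions
    B = suc (N ℕ.* N ℕ.* 5)

    copy : ∀ G → Embedding G positions → (T □ S) ⊑ G
    copy G (x , adjacent , inj) = h , h-injective , h-adjacent
      where
      open Graph G
      h : Graph.V (T □ S) → V
      h (u , v) = vertex (x (nodeT u , nodeS v))
      h-injective : ∀ {p q} → h p ≡ h q → p ≡ q
      h-injective {u , v} {u′ , v′} eq =
        cong₂ _,_ (injectiveT (,-injectiveˡ same)) (injectiveS (,-injectiveʳ same))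
        where
        same : (nodeT u , nodeS v) ≡ (nodeT u′ , nodeS v′)
        same = inj (position∈ u v) (position∈ u′ v′) (vertex-injective eq)
      h-adjacent : ∀ {p q} → Graph.Adj (T □ S) p q → Adj (h p) (h q)
      h-adjacent {u , v} {_ , v′} (inj₁ (refl , v~v′)) with parentS v~v′
      ... | inj₁ (i , eq) = symmetric (adjacent (position∈ u v) (subst (λ s → (nodeT u , nodeS v′) ◁ (nodeT u , s)) (sym eq) right))
      ... | inj₂ (i , eq) = adjacent (position∈ u v′) (subst (λ s → (nodeT u , nodeS v) ◁ (nodeT u , s)) (sym eq) right)
      h-adjacent {u , v} {u′ , _} (inj₂ (refl , u~u′)) with parentT u~u′
      ... | inj₁ (i , eq) = symmetric (adjacent (position∈ u v) (subst (λ t → (nodeT u′ , nodeS v) ◁ (t , nodeS v)) (sym eq) left))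
      ... | inj₂ (i , eq) = adjacent (position∈ u′ v) (subst (λ t → (nodeT u , nodeS v) ◁ (t , nodeS v)) (sym eq) left)

    □-free⇒edges≤ : ∀ G {ℓ} → 1 ℕ.≤ ℓ → Graph.order G ℕ.≤ 4 ℕ.* (ℓ ℕ.* ℓ) → ¬ (T □ S) ⊑ G →
                    edgeCount G ℕ.≤ N ℕ.* N ℕ.* (5 ℕ.* (ℓ ℕ.* Graph.order G))
    □-free⇒edges≤ G {ℓ} 1≤ℓ n≤4ℓ² free = ℕ.≮⇒≥ λ dense →
      free (copy G (dense⇒embedding G ℓ 1≤ℓ n≤4ℓ² (grid-ordered closedT closedS) dense))

    attained-bound : ∀ {n e} → 1 ℕ.≤ n → Attained n (T □ S) e → e ^ 2 ℕ.≤ (B ℕ.* B) ℕ.* n ^ 3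
    attained-bound {n} 1≤n (G , refl , free , refl) with integer-sqrt n
    ... | zero , _ , n<1 = contradiction (ℕ.<-≤-trans n<1 1≤n) (ℕ.<-irrefl refl)
    -- For positive ℓ, 1 + ℓ ≤ 2 ℓ turns n < (1 + ℓ)² into n ≤ 4 ℓ².
    ... | ℓ@(suc _) , ℓ²≤n , n<[1+ℓ]² = square-bound N ℓ ℓ²≤n (□-free⇒edges≤ G {ℓ} (s≤s z≤n)
      (ℕ.≤-trans (ℕ.<⇒≤ n<[1+ℓ]²) (ℕ.≤-trans (ℕ.*-mono-≤ 1+ℓ≤2ℓ 1+ℓ≤2ℓ) (ℕ.≤-reflexive (quadruple ℓ)))) free)
      where
      open Data.Nat.Solver.+-*-Solver
      1+ℓ≤2ℓ : suc ℓ ℕ.≤ ℓ ℕ.+ ℓ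
      1+ℓ≤2ℓ = ℕ.+-monoˡ-≤ ℓ (s≤s z≤n)
      quadruple : ∀ l → (l ℕ.+ l) ℕ.* (l ℕ.+ l) ≡ 4 ℕ.* (l ℕ.* l)
      quadruple = solve 1 (λ l → (l :+ l) :* (l :+ l) := con 4 :* (l :* l)) refl

  upper-bound : ∀ {T S} → IsTree T → IsTree S → HasEdge T → HasEdge S →
                ∃ λ B → 1 ℕ.≤ B × ∀ n → 1 ℕ.≤ n → ex n (T □ S) ^ 2 ℕ.≤ (B ℕ.* B) ℕ.* n ^ 3
  upper-bound {T} {S} tT tS eT eS = B , s≤s z≤n , λ n 1≤n →
    attained-bound 1≤n (proj₁ (ex-isTuránNumber n (T □ S) (□-hasEdge {T} {S} eT eS)))
    where open Copy T S (labelling T tT) (labelling S tS)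

  plane-ex : ∀ {T S p n} → HasEdge T → HasEdge S → Prime p → p ℕ.* p ℕ.+ p ℕ.* p ℕ.≤ n → p ℕ.* (p ℕ.* p) ℕ.≤ ex n (T □ S)
  plane-ex {T} {S} {p} {n} eT eS pr 2p²≤n = ℕ.≤-trans (plane-edges p pr q)
    (proj₂ (ex-isTuránNumber n (T □ S) (□-hasEdge {T} {S} eT eS)) _
      (plane p pr q , order≡ , C₄-free⇒□-free {T} {S} {plane p pr q} eT eS (λ {u} {v} {x} {y} → plane-C₄-free p pr q {u} {v} {x} {y}) , refl))
    where
    q = n ℕ.∸ (p ℕ.* p ℕ.+ p ℕ.* p)
    order≡ : p ℕ.* p ℕ.+ (p ℕ.* p ℕ.+ q) ≡ n
    order≡ = trans (sym (ℕ.+-assoc (p ℕ.* p) (p ℕ.* p) q)) (ℕ.m+[n∸m]≡n 2p²≤n)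

  n<2^n : ∀ n → n ℕ.< 2 ^ n
  n<2^n zero    = s≤s z≤n
  n<2^n (suc n) = ℕ.+-mono-≤ (ℕ.m^n>0 2 n) (ℕ.≤-trans (n<2^n n) (ℕ.≤-reflexive (sym (ℕ.+-identityʳ (2 ^ n)))))

  cube-bound : ∀ k x {n e} → n ℕ.≤ (k ℕ.* x) ℕ.* (k ℕ.* x) ℕ.+ (k ℕ.* x) ℕ.* (k ℕ.* x) → x ℕ.* (x ℕ.* x) ℕ.≤ e →
               n ^ 3 ℕ.≤ 8 ℕ.* ((k ℕ.* (k ℕ.* k)) ℕ.* (k ℕ.* (k ℕ.* k))) ℕ.* e ^ 2
  cube-bound k x {n} {e} n≤ x³≤e = begin
    n ^ 3                             ≤⟨ ℕ.^-monoˡ-≤ 3 n≤ ⟩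
    (z ℕ.* z ℕ.+ z ℕ.* z) ^ 3         ≡⟨ cube z ⟩
    8 ℕ.* (z³ ℕ.* z³)                 ≡⟨ cong (λ m → 8 ℕ.* (m ℕ.* m)) (distrib k x) ⟩
    8 ℕ.* ((k³ ℕ.* x³) ℕ.* (k³ ℕ.* x³)) ≡⟨ collect k³ x³ ⟩
    8 ℕ.* (k³ ℕ.* k³) ℕ.* x³ ^ 2      ≤⟨ ℕ.*-monoʳ-≤ (8 ℕ.* (k³ ℕ.* k³)) (ℕ.^-monoˡ-≤ 2 x³≤e) ⟩
    8 ℕ.* (k³ ℕ.* k³) ℕ.* e ^ 2 ∎
    where
    open ℕ.≤-Reasoning
    open Data.Nat.Solver.+-*-Solver
    z  = k ℕ.* x
    z³ = z ℕ.* (z ℕ.* z)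
    k³ = k ℕ.* (k ℕ.* k)
    x³ = x ℕ.* (x ℕ.* x)
    cube : ∀ z → (z ℕ.* z ℕ.+ z ℕ.* z) ^ 3 ≡ 8 ℕ.* ((z ℕ.* (z ℕ.* z)) ℕ.* (z ℕ.* (z ℕ.* z)))
    cube = solve 1 (λ z → (z :* z :+ z :* z) :^ 3 := con 8 :* ((z :* (z :* z)) :* (z :* (z :* z)))) refl
    distrib : ∀ k x → (k ℕ.* x) ℕ.* ((k ℕ.* x) ℕ.* (k ℕ.* x)) ≡ (k ℕ.* (k ℕ.* k)) ℕ.* (x ℕ.* (x ℕ.* x))
    distrib = solve 2 (λ k x → (k :* x) :* ((k :* x) :* (k :* x)) := (k :* (k :* k)) :* (x :* (x :* x))) refl
    collect : ∀ k x → 8 ℕ.* ((k ℕ.* x) ℕ.* (k ℕ.* x)) ≡ 8 ℕ.* (k ℕ.* k) ℕ.* x ^ 2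
    collect = solve 2 (λ k x → con 8 :* ((k :* x) :* (k :* x)) := con 8 :* (k :* k) :* x :^ 2) refl

  -- Opaque, to keep large powers of two from being evaluated.
  abstract
    scale : ℕ → ℕ
    scale i = 2 ^ (2 ℕ.* (9 ℕ.+ i))

    scale-suc : ∀ i → scale (suc i) ≡ 4 ℕ.* scale i
    scale-suc i = 2^2*suc (9 ℕ.+ i)

    n<scale : ∀ n → n ℕ.< scale n
    n<scale n = ℕ.<-≤-trans (n<2^n n)
      (ℕ.^-monoʳ-≤ 2 (ℕ.≤-trans (ℕ.m≤n+m n 9) (ℕ.m≤m+n (9 ℕ.+ n) _)))

    scale-prime : ∀ i → ∃ λ p → Prime p × scale i ℕ.< p × p ℕ.≤ 4 ℕ.* (4 ℕ.* scale i)
    scale-prime i = prime-between {9 ℕ.+ i} (square≤2^ i)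

  -- The scale x is chosen with 2 (16 x)² ≤ n < 2 (64 x)², so that the graph of a prime in (x , 16
  -- x] fits into n vertices. The constant 64 is 16, from the prime gap, times 4, from one scale to
  -- the next.
  cubic-growth : (e : ℕ → ℕ) → (∀ {p n} → Prime p → p ℕ.* p ℕ.+ p ℕ.* p ℕ.≤ n → p ℕ.* (p ℕ.* p) ℕ.≤ e n) →
                 ∃ λ B → 1 ℕ.≤ B × ∃ λ n₀ → ∀ n → n₀ ℕ.≤ n → n ^ 3 ℕ.≤ B ℕ.* e n ^ 2
  cubic-growth e p³≤e = go 64 refl
    where
    f : ℕ → ℕ
    f i = P ℕ.* P ℕ.+ P ℕ.* P
      where P = 4 ℕ.* (4 ℕ.* scale i)

    n<fn : ∀ n → n ℕ.< f n
    n<fn n = begin-strict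
      n        <⟨ n<scale n ⟩
      scale n  ≤⟨ ℕ.≤-trans (ℕ.m≤n*m (scale n) 4) (ℕ.m≤n*m (4 ℕ.* scale n) 4) ⟩
      P        ≤⟨ ℕ.m≤m*n P P {{ℕ.>-nonZero 0<P}} ⟩
      P ℕ.* P  ≤⟨ ℕ.m≤m+n (P ℕ.* P) (P ℕ.* P) ⟩
      f n      ∎
      where
      open ℕ.≤-Reasoning
      P = 4 ℕ.* (4 ℕ.* scale n)
      0<P : 0 ℕ.< P
      0<P = ℕ.<-≤-trans (ℕ.≤-<-trans z≤n (n<scale n)) (ℕ.≤-trans (ℕ.m≤n*m (scale n) 4) (ℕ.m≤n*m (4 ℕ.* scale n) 4))

    -- k is kept a variable so that its powers are not evaluated.
    go : ∀ k → k ≡ 64 → ∃ λ B → 1 ℕ.≤ B × ∃ λ n₀ → ∀ n → n₀ ℕ.≤ n → n ^ 3 ℕ.≤ B ℕ.* e n ^ 2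
    go k k≡64 = 8 ℕ.* (k³ ℕ.* k³) , ℕ.*-mono-≤ (s≤s {n = 7} z≤n) (ℕ.*-mono-≤ 1≤k³ 1≤k³) , f 0 , bound
      where
      k³ = k ℕ.* (k ℕ.* k)
      1≤k : 1 ℕ.≤ k
      1≤k = subst (1 ℕ.≤_) (sym k≡64) (s≤s z≤n)
      1≤k³ : 1 ℕ.≤ k³
      1≤k³ = ℕ.*-mono-≤ 1≤k (ℕ.*-mono-≤ 1≤k 1≤k)
      bound : ∀ n → f 0 ℕ.≤ n → n ^ 3 ℕ.≤ 8 ℕ.* (k³ ℕ.* k³) ℕ.* e n ^ 2
      bound n f0≤n with bracket f n f0≤n (n<fn n)
      ... | i , fi≤n , n<f with scale-prime i
      ...   | p , pr , x<p , p≤16x = cube-bound k x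
        (ℕ.≤-trans (ℕ.<⇒≤ n<f) (ℕ.≤-reflexive (cong (λ P → P ℕ.* P ℕ.+ P ℕ.* P) P≡kx)))
        (ℕ.≤-trans (ℕ.*-mono-≤ x≤p (ℕ.*-mono-≤ x≤p x≤p)) (p³≤e pr
          (ℕ.≤-trans (ℕ.+-mono-≤ (ℕ.*-mono-≤ p≤16x p≤16x) (ℕ.*-mono-≤ p≤16x p≤16x)) fi≤n)))
        where
        open Data.Nat.Solver.+-*-Solver
        x = scale i
        x≤p : x ℕ.≤ p
        x≤p = ℕ.<⇒≤ x<p
        quadruple : ∀ x → 4 ℕ.* (4 ℕ.* (4 ℕ.* x)) ≡ 64 ℕ.* x
        quadruple = solve 1 (λ x → con 4 :* (con 4 :* (con 4 :* x)) := con 64 :* x) refl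
        P≡kx : 4 ℕ.* (4 ℕ.* scale (suc i)) ≡ k ℕ.* x
        P≡kx = trans (cong (λ y → 4 ℕ.* (4 ℕ.* y)) (scale-suc i)) (trans (quadruple x) (cong (ℕ._* x) (sym k≡64)))

  lower-bound : ∀ {T S} → HasEdge T → HasEdge S →
                ∃ λ B → 1 ℕ.≤ B × ∃ λ n₀ → ∀ n → n₀ ℕ.≤ n → n ^ 3 ℕ.≤ B ℕ.* ex n (T □ S) ^ 2
  lower-bound {T} {S} eT eS = cubic-growth (λ n → ex n (T □ S)) (plane-ex {T} {S} eT eS)

  -- Squaring keeps n^(3/2) inside ℚ. The embedding `j` is a parameter so that the opaque `ι` can be
  -- used first and exchanged for `fromℕℚ` at the end.
  SquaredConstants : (ℕ → ℚ) → (ℕ → ℕ) → Set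
  SquaredConstants j e = ∃₂ λ c C → 0ℚ < c × 0ℚ < C × ∃ λ N → ∀ n → N ℕ.≤ n →
    (c * c) * j (n ^ 3) ≤ j (e n ^ 2) × j (e n ^ 2) ≤ (C * C) * j (n ^ 3)

  transport : ∀ {j j′} e → (∀ m → j m ≡ j′ m) → SquaredConstants j e → SquaredConstants j′ e
  transport e j≡j′ (c , C , 0<c , 0<C , N , bounds) = c , C , 0<c , 0<C , N , λ n N≤n →
    subst₂ (λ y z → (c * c) * y ≤ z) (j≡j′ (n ^ 3)) (j≡j′ (e n ^ 2)) (proj₁ (bounds n N≤n)) ,
    subst₂ (λ y z → y ≤ (C * C) * z) (j≡j′ (e n ^ 2)) (j≡j′ (n ^ 3)) (proj₂ (bounds n N≤n))

  squared-constants : (e : ℕ → ℕ) →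
    (∃ λ B → 1 ℕ.≤ B × ∃ λ n₀ → ∀ n → n₀ ℕ.≤ n → n ^ 3 ℕ.≤ B ℕ.* e n ^ 2) →
    (∃ λ A → 1 ℕ.≤ A × ∀ n → 1 ℕ.≤ n → e n ^ 2 ℕ.≤ (A ℕ.* A) ℕ.* n ^ 3) →
    SquaredConstants ι e
  squared-constants e (B , 1≤B , n₀ , lower) (A , 1≤A , upper) =
    c , C , ≤∧≢⇒< 0≤c (inv≢0 b≢0) , ≤∧≢⇒< (ι-nonneg A) (ι-≢0 1≤A) ,
    -- The successor ensures n ≥ 1, as the upper bound requires.
    suc n₀ , λ n n₀<n → below n (lower n (ℕ.<⇒≤ n₀<n)) , above n (upper n (ℕ.≤-trans (s≤s z≤n) n₀<n))
    where
    open ≤-Reasoning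
    open +-*-Solver
    b c C : ℚ
    b = ι B
    -- The lower bound would allow 1/√B; 1/B is rational and, as B ≥ 1, no larger.
    c = inv b
    C = ι A
    b≢0 : b ≢ 0ℚ
    b≢0 = ι-≢0 1≤B
    0≤c : 0ℚ ≤ c
    0≤c = inv-nonneg (ι-nonneg B)
    rearrange : ∀ c b z → c * c * (b * b * z) ≡ (b * c) * ((b * c) * z)
    rearrange = solve 3 (λ c b z → c :* c :* (b :* b :* z) := (b :* c) :* ((b :* c) :* z)) refl
    below : ∀ n → n ^ 3 ℕ.≤ B ℕ.* e n ^ 2 → (c * c) * ι (n ^ 3) ≤ ι (e n ^ 2)
    below n n³≤ = begin
      c * c * ι (n ^ 3)                   ≤⟨ *-mono-≤ˡ (0≤* 0≤c 0≤c) (ι-mono n³≤BBe²) ⟩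
      c * c * ι (B ℕ.* B ℕ.* e n ^ 2)     ≡⟨ cong (c * c *_) (trans (ι-* (B ℕ.* B) (e n ^ 2)) (cong (_* e²) (ι-* B B))) ⟩
      c * c * (b * b * e²)                ≡⟨ rearrange c b e² ⟩
      (b * c) * ((b * c) * e²)            ≡⟨ cong₂ (λ y z → y * (z * e²)) (*-inv b≢0) (*-inv b≢0) ⟩
      1ℚ * (1ℚ * e²)                      ≡⟨ trans (*-identityˡ _) (*-identityˡ e²) ⟩
      e² ∎
      where
      e² = ι (e n ^ 2)
      n³≤BBe² : n ^ 3 ℕ.≤ B ℕ.* B ℕ.* e n ^ 2
      n³≤BBe² = ℕ.≤-trans n³≤ (ℕ.*-monoˡ-≤ (e n ^ 2) (ℕ.m≤m*n B B {{ℕ.>-nonZero 1≤B}}))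
    above : ∀ n → e n ^ 2 ℕ.≤ (A ℕ.* A) ℕ.* n ^ 3 → ι (e n ^ 2) ≤ (C * C) * ι (n ^ 3)
    above n e²≤ = ≤-trans (ι-mono e²≤)
      (≤-reflexive (trans (ι-* (A ℕ.* A) (n ^ 3)) (cong (_* ι (n ^ 3)) (ι-* A A))))

open Bounds
open import Data.Nat using (ℕ; _≤_; _^_)
open import Data.Rational as ℚ using (ℚ; 0ℚ)

theorem1p5 : (T S : Graph) → IsTree T → IsTree S → HasEdge T → HasEdge S →
    ∃₂ λ (c C : ℚ) → 0ℚ ℚ.< c × 0ℚ ℚ.< C ×
    ∃ λ (N : ℕ) → ∀ (n : ℕ) → N ≤ n →
    (c ℚ.* c) ℚ.* fromℕℚ (n ^ 3) ℚ.≤ fromℕℚ (ex n (T □ S) ^ 2) ×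
    fromℕℚ (ex n (T □ S) ^ 2) ℚ.≤ (C ℚ.* C) ℚ.* fromℕℚ (n ^ 3)
theorem1p5 T S tT tS eT eS = transport (λ n → ex n (T □ S)) RationalSums.ι≡fromℕℚ
  (squared-constants (λ n → ex n (T □ S)) (lower-bound {T} {S} eT eS) (upper-bound {T} {S} tT tS eT eS))
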